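{- For every positive integer $v\equiv 0\pmod{12}$, $\mathrm{URD}(v;P_2,P_3,P_4)=D(v)$. That is, for non-negative integers $r,s,t$, there exists a $(P_2,P_3,P_4)$-URD$(v;r,s,t)$ if and only if $(r,s,t)\in D(v)$.
   Context: $P_k$ denotes the path on $k$ vertices (so $P_2=K_2$ is a single edge), and $K_v$ the complete graph on $v$ vertices. A parallel class of a graph $G$ is a set of subgraphs (blocks) of $G$ such that every vertex of $G$ lies in exactly one block of the set. A $(P_2,P_3,P_4)$-URD$(v;r,s,t)$ is a partition of the edge set of $K_v$ into blocks (subgraphs isomorphic to $P_2$, $P_3$ or $P_4$), together with a partition of the set of blocks into parallel classes of $K_v$, such that exactly $r$ classes consist only of copies of $P_2$, exactly $s$ classes consist only of copies of $P_3$, exactly $t$ classes consist only of copies of $P_4$, and there are no other classes. $\mathrm{URD}(v;P_2,P_3,P_4)$ is the set of all triples $(r,s,t)$ of non-negative integers for which a $(P_2,P_3,P_4)$-URD$(v;r,s,t)$ exists. For $v\equiv 0\pmod{12}$ and an integer $0\le u\le \frac{v-1}{4}$, put $r(v,u)=\frac{v-3}{3}-\frac{4u}{3}$ if $u\equiv 0\pmod 3$; $r(v,u)=\frac{v-6}{3}-\frac{4(u-1)}{3}$ if $u\equiv 1\pmod 3$; $r(v,u)=\frac{v-9}{3}-\frac{4(u-2)}{3}$ if $u\equiv 2\pmod 3$. For $i=0,1,\dots,\frac{v-4}{4}$ let $D_i(v)=\{(v-1-4i-3y,\,3i,\,2y): y\in\mathbb{Z},\ 0\le y\le r(v,i)\}$,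 and let $D(v)=\bigcup_{i=0}^{(v-4)/4}D_i(v)$. -}

module Defs where

open import Data.Bool.Base using (Bool; T)
open import Data.Fin.Base using (Fin; toℕ)
open import Data.Fin.Subset using (Subset; ∣_∣; _∈_)
open import Data.Integer.Base using (ℤ; +_; 0ℤ; _-_; _*_; _≤_)
open import Data.Integer.DivMod using (_/_)
open import Data.Nat.Base using (ℕ; suc)
open import Data.Nat.DivMod using (_%_)
open import Data.Nat.Properties using (1+n≢n)
open import Data.Product.Base using (Σ; Σ-syntax; ∃-syntax; _×_; _,_; proj₁)
open import Data.Product using (∃!)
open import Data.Sum.Base using (_⊎_; inj₁; inj₂; swap)
open import Function.Base using (_∘_)
open import Function.Bundles using (_⇔_; _↔_; Inverse)
open import Level using (0ℓ)
open import Relation.Binary.Core using (Rel)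
open import Relation.Binary.PropositionalEquality using (_≡_; _≢_; refl; ≢-sym)
open import Relation.Nullary.Negation.Core using (¬_)
open import Relation.Unary using (Pred)

record Graph : Set₁ where
  field
    Vertex      : Set
    Adj         : Rel Vertex 0ℓ
    symmetric   : ∀ {x y} → Adj x y → Adj y x
    irreflexive : ∀ {x} → ¬ Adj x x

open Graph public using (Vertex; Adj)

record _≅_ (G H : Graph) : Set where
  field
    bijection : Vertex G ↔ Vertex H
    adjacency : ∀ x y → Adj G x y ⇔ Adj H (Inverse.to bijection x) (Inverse.to bijection y)

infix 4 _≅_

K : ℕ → Graph
K v = record
  { Vertex      = Fin v
  ; Adj         = _≢_
  ; symmetric   = ≢-sym
  ; irreflexive = λ x≢x → x≢x refl
  }

-- The index k counts vertices, so P k has k ∸ 1 edges.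
P : ℕ → Graph
P k = record
  { Vertex      = Fin k
  ; Adj         = λ i j → suc (toℕ i) ≡ toℕ j ⊎ suc (toℕ j) ≡ toℕ i
  ; symmetric   = swap
  ; irreflexive = λ { (inj₁ eq) → 1+n≢n eq ; (inj₂ eq) → 1+n≢n eq }
  }

-- Not necessarily induced.  Membership is Bool-valued so that a subgraph is
-- determined by its vertex and edge sets alone.
record Subgraph (G : Graph) : Set where
  field
    hasVertex : Vertex G → Bool
    hasEdge   : Vertex G → Vertex G → Bool
    edge-sym  : ∀ {x y} → T (hasEdge x y) → T (hasEdge y x)
    edge-end  : ∀ {x y} → T (hasEdge x y) → T (hasVertex x)
    edge-in-G : ∀ {x y} → T (hasEdge x y) → Adj G x y

  asGraph : Graph
  asGraph = record
    { Vertex      = Σ (Vertex G) (T ∘ hasVertex)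
    ; Adj         = λ p q → T (hasEdge (proj₁ p) (proj₁ q))
    ; symmetric   = edge-sym
    ; irreflexive = λ e → Graph.irreflexive G (edge-in-G e)
    }

open Subgraph public using (hasVertex; hasEdge; asGraph)

-- C selects the members of the class from an indexed family of blocks.
IsParallelClass : {G : Graph} {I : Set} → (I → Subgraph G) → Pred I 0ℓ → Set
IsParallelClass {G} block C =
  ∀ (x : Vertex G) → ∃! _≡_ λ b → C b × T (hasVertex (block b) x)

Exactly : ℕ → {m : ℕ} → Pred (Fin m) 0ℓ → Set
Exactly n {m} Q = Σ[ S ∈ Subset m ] ∣ S ∣ ≡ n × (∀ c → c ∈ S ⇔ Q c)

-- Blocks and classes are indexed families.  For v > 0 these are sets without
-- repetition: each edge lies in the block of only one index and every block
-- has an edge; each block lies in one class and, as classes cover the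
-- vertices, no class is empty.
record URD (v r s t : ℕ) : Set where
  field
    #blocks  : ℕ
    block    : Fin #blocks → Subgraph (K v)
    isPath   : ∀ b → asGraph (block b) ≅ P 2 ⊎ asGraph (block b) ≅ P 3 ⊎ asGraph (block b) ≅ P 4
    edges    : ∀ x y → Adj (K v) x y → ∃! _≡_ λ b → T (hasEdge (block b) x y)
    #classes : ℕ
    classOf  : Fin #blocks → Fin #classes
    parallel : ∀ c → IsParallelClass block (λ b → classOf b ≡ c)

  ConsistsOf : ℕ → Pred (Fin #classes) 0ℓ
  ConsistsOf k c = ∀ b → classOf b ≡ c → asGraph (block b) ≅ P k

  field
    exactly-r : Exactly r (ConsistsOf 2)
    exactly-s : Exactly s (ConsistsOf 3)
    exactly-t : Exactly t (ConsistsOf 4)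
    no-other  : ∀ c → ConsistsOf 2 c ⊎ ConsistsOf 3 c ⊎ ConsistsOf 4 c

Triple : Set
Triple = ℤ × ℤ × ℤ

-- Triples of non-negative integers, placed in ℤ³ where D v is defined.
data URDSet (v : ℕ) : Pred Triple 0ℓ where
  urd : ∀ {r s t} → URD v r s t → URDSet v (+ r , + s , + t)

-- All divisions by 3 are exact when v is a multiple of 3.
rMax : ℕ → ℕ → ℤ
rMax v u with u % 3
... | 0 = (+ v - + 3) / + 3 - (+ 4 * + u) / + 3
... | 1 = (+ v - + 6) / + 3 - (+ 4 * (+ u - + 1)) / + 3
... | _ = (+ v - + 9) / + 3 - (+ 4 * (+ u - + 2)) / + 3

Dᵢ : (v i : ℕ) → Pred Triple 0ℓ
Dᵢ v i p = ∃[ y ] 0ℤ ≤ y × y ≤ rMax v i ×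
  p ≡ (+ v - + 1 - + 4 * + i - + 3 * y , + 3 * + i , + 2 * y)

-- The division by 4 is exact when v is a multiple of 4.
D : ℕ → Pred Triple 0ℓ
D v p = ∃[ i ] + i ≤ (+ v - + 4) / + 4 × Dᵢ v i p

{-# OPTIONS --safe #-}

-- A class of P₂s, P₃s or P₄s has v/2, 2v/3 or 3v/4 edges, so counting the edges
-- of K_v gives 6r + 8s + 9t = 6(v - 1).  Hence s = 3i and t = 2y with
-- r + 4i + 3y = v - 1, and D(v) consists of exactly these triples.
--
-- Conversely let v = 12k, and put six vertices above each node of K_2k.  The
-- cyclic 1-factorization F_0, ..., F_(2k-2) of K_2k (nodes ∞ and x mod 2k-1,
-- where F_i joins x and y if x + y ≡ i) splits K_v into a bundle of k copies of
-- K_12 above F_0 and, for 0 < J < k, a 12-regular bundle: the six-fold blow-up of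
-- the even cycles F_(2J-1) ∪ F_2J.  The latter resolves into 9 classes of P₃s,
-- and also into four cubic graphs, each of which is the union of three 1-factors
-- and of two classes of P₄s.  The former resolves, for i ≤ 2, into 3i classes of
-- P₃s, 3 - i such cubic graphs, and 2 - i further 1-factors.  Distributing i and y
-- greedily over the bundles realizes every triple of D(v).
--
-- In all these resolutions the block through a vertex is determined by local
-- data: its position among the six vertices above its node, and the colour of
-- the node in a 2-colouring of the bundle.  So their correctness is a check of
-- finitely many cases.
module Submission where

open import Defs
open import Data.Bool.Base using (Bool; true; false; not; T; _∧_; _∨_; _xor_; if_then_else_)
open import Data.Bool.Properties using (T-irrelevant; T-∧) renaming (_≟_ to _≟ᵇ_)
open import Data.Empty using (⊥)
open import Data.Fin.Base using (Fin; zero; suc; toℕ; fromℕ<)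
open import Data.Fin.Patterns using (0F; 1F; 2F; 3F; 4F)
open import Data.Fin.Permutation using (↔⇒≡)
open import Data.Fin.Properties using (toℕ<n; toℕ-injective; toℕ-fromℕ<; all?; 1↔⊤; 2↔Bool; +↔⊎; *↔×)
  renaming (_≟_ to _≟ᶠ_)
open import Data.Fin.Subset using (Subset; ∣_∣; _∈_; inside; outside)
open import Data.List.Base using (List; []; _∷_; map; length; _++_; concat)
  renaming (lookup to lookupᴸ; tabulate to tabulateᴸ)
open import Data.List.Properties using (map-++)
open import Data.List.Relation.Unary.All using (All; []; _∷_) renaming (all? to All?)
open import Data.Nat.Base
open import Data.Nat.Divisibility using (_∣_; divides; ∣m+n∣m⇒∣n)
open import Data.Nat.DivMod using (_%_; _/_; [m+kn]%n≡m%n; m*n/n≡m; m≡m%n+[m/n]*n; m%n<n)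
open import Data.Nat.ListAction using () renaming (sum to sumᴸ)
open import Data.Nat.ListAction.Properties using (sum-++)
open import Data.Nat.Properties
open import Data.Nat.Tactic.RingSolver using (solve-∀)
open import Data.Product.Base using (Σ; Σ-syntax; ∃-syntax; _×_; _,_; proj₁; proj₂)
open import Data.Product using (∃!)
open import Data.Product.Function.NonDependent.Propositional using (_×-↔_)
open import Data.Product.Properties using (,-injective)
open import Data.Sum.Base using (_⊎_; inj₁; inj₂; swap)
open import Data.Sum.Function.Propositional using (_⊎-↔_)
open import Data.Vec.Base using ([]; _∷_; lookup; tabulate)
open import Data.Vec.Properties using ([]=⇒lookup; lookup⇒[]=; lookup∘tabulate)
open import Function.Base using (_∘_; case_of_)
open import Function.Bundles using (_↔_; _⇔_; mk⇔; mk↔ₛ′; Inverse; Equivalence)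
open import Function.Properties.Inverse using (↔-refl; ↔-sym; ↔-trans)
open import Relation.Binary.Definitions using (DecidableEquality; tri<; tri≈; tri>)
open import Relation.Binary.PropositionalEquality hiding ([_])
open import Relation.Nullary.Decidable
  using (Dec; does; yes; no; map′; toWitness; fromWitness; ⌊_⌋; dec-true; dec-false; does-⇔;
         _×-dec_; _⊎-dec_; _→-dec_)
open import Relation.Nullary.Negation.Core using (¬_; contradiction)
open import Relation.Unary using (_≐_)

open import Algebra.Properties.Semiring.Sum +-*-semiring
  using (sum-syntax; sum-cong-≗; ∑-comm; ∑-distrib-+; *-distribˡ-sum)

-- Counting finite sets by sums of indicators

[_] : Bool → ℕ
[ false ] = 0
[ true  ] = 1

[]↔T : ∀ b → T b ↔ Fin [ b ]
[]↔T false = mk↔ₛ′ (λ ()) (λ ()) (λ ()) (λ ())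
[]↔T true  = ↔-sym 1↔⊤

Σ-suc↔⊎ : ∀ {n} (P : Fin (suc n) → Set) → Σ (Fin (suc n)) P ↔ (P zero ⊎ Σ (Fin n) (P ∘ suc))
Σ-suc↔⊎ P = mk↔ₛ′
  (λ { (zero , p) → inj₁ p ; (suc i , p) → inj₂ (i , p) })
  (λ { (inj₁ p) → zero , p ; (inj₂ (i , p)) → suc i , p })
  (λ { (inj₁ _) → refl ; (inj₂ _) → refl })
  (λ { (zero , _) → refl ; (suc _ , _) → refl })

ΣFin↔Fin : ∀ {n} {P : Fin n → Set} (m : Fin n → ℕ) → (∀ i → P i ↔ Fin (m i)) →
           Σ (Fin n) P ↔ Fin (∑[ i < n ] m i)
ΣFin↔Fin {zero}      m P↔ = mk↔ₛ′ (λ ()) (λ ()) (λ ()) (λ ())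
ΣFin↔Fin {suc n} {P} m P↔ =
  ↔-trans (Σ-suc↔⊎ P) (↔-trans (P↔ zero ⊎-↔ ΣFin↔Fin (m ∘ suc) (P↔ ∘ suc)) (↔-sym +↔⊎))

ΣT↔Fin : ∀ {n} (h : Fin n → Bool) → Σ (Fin n) (T ∘ h) ↔ Fin (∑[ i < n ] [ h i ])
ΣT↔Fin h = ΣFin↔Fin ([_] ∘ h) ([]↔T ∘ h)

ΣΣT↔Fin : ∀ {n m} (h : Fin n → Fin m → Bool) →
          (Σ[ i ∈ Fin n ] Σ[ j ∈ Fin m ] T (h i j)) ↔ Fin (∑[ i < n ] ∑[ j < m ] [ h i j ])
ΣΣT↔Fin h = ΣFin↔Fin _ (ΣT↔Fin ∘ h)

T-Σ-≡ : ∀ {A : Set} {h : A → Bool} {p q : Σ A (T ∘ h)} → proj₁ p ≡ proj₁ q → p ≡ q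
T-Σ-≡ {p = x , t} {.x , u} refl = cong (x ,_) (T-irrelevant t u)

-- The sum is the cardinality of the subtype, which unique existence makes a singleton.
∑-∃! : ∀ {n} (h : Fin n → Bool) → ∃! _≡_ (T ∘ h) → ∑[ i < n ] [ h i ] ≡ 1
∑-∃! h (i , ti , unique) = ↔⇒≡ (↔-trans (↔-sym (ΣT↔Fin h)) contract)
  where
  contract : Σ _ (T ∘ h) ↔ Fin 1
  contract = mk↔ₛ′ (λ _ → 0F) (λ _ → i , ti) (λ { 0F → refl ; (suc ()) }) (λ (j , tj) → T-Σ-≡ (unique tj))

-- Vertices and edges of a block

adjacent : ∀ {k} → Fin k → Fin k → Bool
adjacent i j = ⌊ suc (toℕ i) ≟ toℕ j ⊎-dec suc (toℕ j) ≟ toℕ i ⌋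

module _ {v : ℕ} (S : Subgraph (K v)) {k : ℕ} (iso : asGraph S ≅ P k) where
  open _≅_ iso
  open Inverse bijection using (to; from; strictlyInverseˡ; strictlyInverseʳ)

  ∑-vertices : ∑[ x < v ] [ hasVertex S x ] ≡ k
  ∑-vertices = ↔⇒≡ (↔-trans (↔-sym (ΣT↔Fin (hasVertex S))) bijection)

  private
    end₁ : ∀ x y → T (hasEdge S x y) → Vertex (asGraph S)
    end₁ x y e = x , Subgraph.edge-end S e

    end₂ : ∀ x y → T (hasEdge S x y) → Vertex (asGraph S)
    end₂ x y e = y , Subgraph.edge-end S (Subgraph.edge-sym S e)

    edge-≡ : ∀ {A : Set} {h : A → A → Bool} {p q : Σ[ x ∈ A ] Σ[ y ∈ A ] T (h x y)} →
             proj₁ p ≡ proj₁ q → proj₁ (proj₂ p) ≡ proj₁ (proj₂ q) → p ≡ q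
    edge-≡ {p = x , y , e} {.x , .y , e′} refl refl = cong (λ e → x , y , e) (T-irrelevant e e′)

    edges↔adjacencies : (Σ[ x ∈ Fin v ] Σ[ y ∈ Fin v ] T (hasEdge S x y)) ↔
                        (Σ[ i ∈ Fin k ] Σ[ j ∈ Fin k ] T (adjacent i j))
    edges↔adjacencies = mk↔ₛ′
      (λ (x , y , e) → to (end₁ x y e) , to (end₂ x y e) ,
        fromWitness (Equivalence.to (adjacency (end₁ x y e) (end₂ x y e)) e))
      (λ (i , j , a) → proj₁ (from i) , proj₁ (from j) ,
        Equivalence.from (adjacency (from i) (from j))
          (subst₂ (Adj (P k)) (sym (strictlyInverseˡ i)) (sym (strictlyInverseˡ j)) (toWitness a)))
      (λ (i , j , a) → edge-≡ (trans (cong to (T-Σ-≡ refl)) (strictlyInverseˡ i))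
                              (trans (cong to (T-Σ-≡ refl)) (strictlyInverseˡ j)))
      (λ (x , y , e) → edge-≡ (cong proj₁ (strictlyInverseʳ (end₁ x y e)))
                              (cong proj₁ (strictlyInverseʳ (end₂ x y e))))

  -- Ordered pairs are counted, so each edge occurs twice; for k = 2, 3, 4 the value is 2, 4, 6.
  ∑-edges : ∑[ x < v ] ∑[ y < v ] [ hasEdge S x y ] ≡ ∑[ i < k ] ∑[ j < k ] [ adjacent i j ]
  ∑-edges = ↔⇒≡ (↔-trans (↔-sym (ΣΣT↔Fin (hasEdge S)))
              (↔-trans edges↔adjacencies (ΣΣT↔Fin (adjacent {k}))))

∑-lookup : ∀ {n} (S : Subset n) → ∑[ i < n ] [ lookup S i ] ≡ ∣ S ∣
∑-lookup []            = refl
∑-lookup (inside  ∷ S) = cong suc (∑-lookup S)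
∑-lookup (outside ∷ S) = ∑-lookup S

∑-const : ∀ n c → ∑[ i < n ] c ≡ n * c
∑-const zero    c = refl
∑-const (suc n) c = cong (c +_) (∑-const n c)

∑-ones : ∀ {n} (f : Fin n → ℕ) → (∀ i → f i ≡ 1) → ∑[ i < n ] f i ≡ n
∑-ones {n} f f≡1 = trans (sum-cong-≗ f≡1) (trans (∑-const n 1) (*-identityʳ n))

∑-zeros : ∀ {n} (f : Fin n → ℕ) → (∀ i → f i ≡ 0) → ∑[ i < n ] f i ≡ 0
∑-zeros {n} f f≡0 = trans (sum-cong-≗ f≡0) (trans (∑-const n 0) (*-zeroʳ n))

[]-∧ : ∀ a b → [ a ] * [ b ] ≡ [ a ∧ b ]
[]-∧ false b     = refl
[]-∧ true  false = refl
[]-∧ true  true  = refl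

∑-≡ : ∀ {n} (x : Fin n) → ∑[ y < n ] [ ⌊ x ≟ᶠ y ⌋ ] ≡ 1
∑-≡ x = ∑-∃! _ (x , fromWitness refl , toWitness)

P-unique : ∀ {G k l} → G ≅ P k → G ≅ P l → k ≡ l
P-unique p q = ↔⇒≡ (↔-trans (↔-sym (_≅_.bijection p)) (_≅_.bijection q))

-- With edges counted as ordered pairs, a class of P₂s, P₃s or P₄s has v, 4v/3 or 3v/2 of them; the
-- factor 6 turns these into 6v, 8v and 9v.
blend : (v a b c : ℕ) → ℕ
blend v a b c = 6 * v * a + (8 * v * b + 9 * v * c)

blend-cong : ∀ v {a a′ b b′ c c′} → a ≡ a′ → b ≡ b′ → c ≡ c′ → blend v a b c ≡ blend v a′ b′ c′
blend-cong v refl refl refl = refl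

two-share : ∀ w v → 2 * w ≡ 2 * v → 6 * w ≡ blend v 1 0 0
two-share w v eq = trans (p w) (trans (cong (3 *_) eq) (q v))
  where
  p : ∀ w → 6 * w ≡ 3 * (2 * w)
  p = solve-∀
  q : ∀ v → 3 * (2 * v) ≡ 6 * v * 1 + (8 * v * 0 + 9 * v * 0)
  q = solve-∀

three-share : ∀ w v → 3 * w ≡ 4 * v → 6 * w ≡ blend v 0 1 0
three-share w v eq = trans (p w) (trans (cong (2 *_) eq) (q v))
  where
  p : ∀ w → 6 * w ≡ 2 * (3 * w)
  p = solve-∀
  q : ∀ v → 2 * (4 * v) ≡ 6 * v * 0 + (8 * v * 1 + 9 * v * 0)
  q = solve-∀

four-share : ∀ w v → 4 * w ≡ 6 * v → 6 * w ≡ blend v 0 0 1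
four-share w v eq = *-cancelˡ-≡ _ _ 2 (trans (p w) (trans (cong (3 *_) eq) (q v)))
  where
  p : ∀ w → 2 * (6 * w) ≡ 3 * (4 * w)
  p = solve-∀
  q : ∀ v → 3 * (6 * v) ≡ 2 * (6 * v * 0 + (8 * v * 0 + 9 * v * 1))
  q = solve-∀

-- The degree equation by double counting

module Counting {v r s t : ℕ} (D : URD v r s t) (0<v : 0 < v) where
  open URD D

  V# E# : Fin #blocks → ℕ
  V# b = ∑[ x < v ] [ hasVertex (block b) x ]
  E# b = ∑[ x < v ] ∑[ y < v ] [ hasEdge (block b) x y ]

  lies : Fin #blocks → Fin #classes → Bool
  lies b c = ⌊ classOf b ≟ᶠ c ⌋

  weight : Fin #classes → ℕ
  weight c = ∑[ b < #blocks ] ([ lies b c ] * E# b)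

  -- Double counting of incidences: each vertex lies in exactly one block of the class.
  class-order : ∀ c → ∑[ b < #blocks ] ([ lies b c ] * V# b) ≡ v
  class-order c = begin
    ∑[ b < #blocks ] ([ lies b c ] * V# b)
      ≡⟨ sum-cong-≗ (λ b → *-distribˡ-sum [ lies b c ] (λ x → [ hasVertex (block b) x ])) ⟩
    ∑[ b < #blocks ] ∑[ x < v ] ([ lies b c ] * [ hasVertex (block b) x ])
      ≡⟨ ∑-comm (λ b x → [ lies b c ] * [ hasVertex (block b) x ]) ⟩
    ∑[ x < v ] ∑[ b < #blocks ] ([ lies b c ] * [ hasVertex (block b) x ])
      ≡⟨ ∑-ones _ (λ x → trans (sum-cong-≗ (λ b → []-∧ (lies b c) _)) (∑-∃! _ (once x))) ⟩
    v ∎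
    where
    open ≡-Reasoning
    once : ∀ x → ∃! _≡_ λ b → T (lies b c ∧ hasVertex (block b) x)
    once x with parallel c x
    ... | b , (b∈c , x∈b) , unique =
      b , Equivalence.from T-∧ (fromWitness b∈c , x∈b) ,
      λ h → case Equivalence.to T-∧ h of λ (b∈c , x∈b) → unique (toWitness b∈c , x∈b)

  -- Each block of the class has k vertices and ε ordered edges, so the two counts are proportional
  -- block by block; over the whole class the vertices add up to v.
  class-weight : ∀ {k} c → ConsistsOf k c →
                 k * weight c ≡ (∑[ i < k ] ∑[ j < k ] [ adjacent i j ]) * v
  class-weight {k} c ofP = begin
    k * weight c
      ≡⟨ *-distribˡ-sum k (λ b → [ lies b c ] * E# b) ⟩
    ∑[ b < #blocks ] (k * ([ lies b c ] * E# b))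
      ≡⟨ sum-cong-≗ exchange ⟩
    ∑[ b < #blocks ] (ε * ([ lies b c ] * V# b))
      ≡⟨ *-distribˡ-sum ε (λ b → [ lies b c ] * V# b) ⟨
    ε * ∑[ b < #blocks ] ([ lies b c ] * V# b)
      ≡⟨ cong (ε *_) (class-order c) ⟩
    ε * v ∎
    where
    open ≡-Reasoning
    ε : ℕ
    ε = ∑[ i < k ] ∑[ j < k ] [ adjacent i j ]
    exchange : ∀ b → k * ([ lies b c ] * E# b) ≡ ε * ([ lies b c ] * V# b)
    exchange b with classOf b ≟ᶠ c
    ... | no  _   = trans (*-zeroʳ k) (sym (*-zeroʳ ε))
    ... | yes b∈c = begin
      k * (1 * E# b) ≡⟨ cong (k *_) (trans (*-identityˡ _) (∑-edges (block b) (ofP b b∈c))) ⟩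
      k * ε          ≡⟨ *-comm k ε ⟩
      ε * k          ≡⟨ cong (ε *_) (trans (*-identityˡ _) (∑-vertices (block b) (ofP b b∈c))) ⟨
      ε * (1 * V# b) ∎

  ∑-weight : ∑[ c < #classes ] weight c ≡ ∑[ b < #blocks ] E# b
  ∑-weight = begin
    ∑[ c < #classes ] ∑[ b < #blocks ] ([ lies b c ] * E# b)
      ≡⟨ ∑-comm (λ c b → [ lies b c ] * E# b) ⟩
    ∑[ b < #blocks ] ∑[ c < #classes ] ([ lies b c ] * E# b)
      ≡⟨ sum-cong-≗ (λ b → begin
        ∑[ c < #classes ] ([ lies b c ] * E# b)
          ≡⟨ sum-cong-≗ (λ c → *-comm [ lies b c ] (E# b)) ⟩
        ∑[ c < #classes ] (E# b * [ lies b c ])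
          ≡⟨ *-distribˡ-sum (E# b) (λ c → [ lies b c ]) ⟨
        E# b * (∑[ c < #classes ] [ lies b c ])
          ≡⟨ cong (E# b *_) (∑-≡ (classOf b)) ⟩
        E# b * 1
          ≡⟨ *-identityʳ (E# b) ⟩
        E# b ∎) ⟩
    ∑[ b < #blocks ] E# b ∎
    where open ≡-Reasoning

  -- The summand v is the diagonal: of the v² ordered pairs, those off it are covered by one block
  -- each, those on it by none.
  ∑-E# : ∑[ b < #blocks ] E# b + v ≡ v * v
  ∑-E# = begin
    ∑[ b < #blocks ] E# b + v
      ≡⟨ cong₂ _+_ swap-sums (sym (∑-ones {v} _ ∑-≡)) ⟩
    ∑[ x < v ] ∑[ y < v ] covered x y + ∑[ x < v ] ∑[ y < v ] [ ⌊ x ≟ᶠ y ⌋ ]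
      ≡⟨ ∑-distrib-+ (λ x → ∑[ y < v ] covered x y) (λ x → ∑[ y < v ] [ ⌊ x ≟ᶠ y ⌋ ]) ⟨
    ∑[ x < v ] (∑[ y < v ] covered x y + ∑[ y < v ] [ ⌊ x ≟ᶠ y ⌋ ])
      ≡⟨ sum-cong-≗ (λ x → ∑-distrib-+ (covered x) (λ y → [ ⌊ x ≟ᶠ y ⌋ ])) ⟨
    ∑[ x < v ] ∑[ y < v ] (covered x y + [ ⌊ x ≟ᶠ y ⌋ ])
      ≡⟨ sum-cong-≗ (λ x → ∑-ones _ (once x)) ⟩
    ∑[ x < v ] v
      ≡⟨ ∑-const v v ⟩
    v * v ∎
    where
    open ≡-Reasoning
    covered : Fin v → Fin v → ℕ
    covered x y = ∑[ b < #blocks ] [ hasEdge (block b) x y ]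
    swap-sums : ∑[ b < #blocks ] E# b ≡ ∑[ x < v ] ∑[ y < v ] covered x y
    swap-sums = trans (∑-comm (λ b x → ∑[ y < v ] [ hasEdge (block b) x y ]))
                      (sum-cong-≗ (λ x → ∑-comm (λ b y → [ hasEdge (block b) x y ])))
    once : ∀ x y → covered x y + [ ⌊ x ≟ᶠ y ⌋ ] ≡ 1
    once x y with x ≟ᶠ y
    ... | no  x≢y  = trans (+-identityʳ _) (∑-∃! _ (edges x y x≢y))
    ... | yes refl = cong (_+ 1) (∑-zeros _ loopless)
      where
      loopless : ∀ b → [ hasEdge (block b) x x ] ≡ 0
      loopless b with hasEdge (block b) x x in eq
      ... | false = refl
      ... | true  = contradiction refl (Subgraph.edge-in-G (block b) (subst T (sym eq) _))

  -- An empty class would consist of paths of every order at once. Having a vertex to cover excludes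
  -- this.
  member : ∀ c → ∃[ b ] classOf b ≡ c
  member c = let b , (b∈c , _) , _ = parallel c (fromℕ< 0<v) in b , b∈c

  unmixed : ∀ {k l c} → k ≢ l → ConsistsOf k c → ¬ ConsistsOf l c
  unmixed {c = c} k≢l ofPₖ ofPₗ with member c
  ... | b , b∈c = k≢l (P-unique (ofPₖ b b∈c) (ofPₗ b b∈c))

  module _ {n k} (exactly : Exactly n (ConsistsOf k)) where
    private
      S = proj₁ exactly
    hit : ∀ {c} → ConsistsOf k c → [ lookup S c ] ≡ 1
    hit {c} ofP = cong [_] ([]=⇒lookup (Equivalence.from (proj₂ (proj₂ exactly) c) ofP))
    miss : ∀ {c} → ¬ ConsistsOf k c → [ lookup S c ] ≡ 0
    miss {c} ¬ofP with lookup S c in eq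
    ... | false = refl
    ... | true  = contradiction (Equivalence.to (proj₂ (proj₂ exactly) c) (lookup⇒[]= c S eq)) ¬ofP

  S₂ S₃ S₄ : Subset #classes
  S₂ = proj₁ exactly-r
  S₃ = proj₁ exactly-s
  S₄ = proj₁ exactly-t

  share : Fin #classes → ℕ
  share c = blend v [ lookup S₂ c ] [ lookup S₃ c ] [ lookup S₄ c ]

  weight-share : ∀ c → 6 * weight c ≡ share c
  weight-share c with no-other c
  ... | inj₁ of2 = trans (two-share (weight c) v (class-weight c of2))
    (sym (blend-cong v (hit exactly-r of2) (miss exactly-s (unmixed (λ ()) of2))
                       (miss exactly-t (unmixed (λ ()) of2))))
  ... | inj₂ (inj₁ of3) = trans (three-share (weight c) v (class-weight c of3))
    (sym (blend-cong v (miss exactly-r (λ of2 → unmixed (λ ()) of2 of3)) (hit exactly-s of3)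
                       (miss exactly-t (unmixed (λ ()) of3))))
  ... | inj₂ (inj₂ of4) = trans (four-share (weight c) v (class-weight c of4))
    (sym (blend-cong v (miss exactly-r (λ of2 → unmixed (λ ()) of2 of4))
                       (miss exactly-s (λ of3 → unmixed (λ ()) of3 of4)) (hit exactly-t of4)))

  ∑-share : ∑[ c < #classes ] share c ≡ 6 * v * r + (8 * v * s + 9 * v * t)
  ∑-share = trans (∑-distrib-+ (λ c → 6 * v * [ lookup S₂ c ]) _) (cong₂ _+_ (scale (6 * v) exactly-r)
    (trans (∑-distrib-+ (λ c → 8 * v * [ lookup S₃ c ]) _)
           (cong₂ _+_ (scale (8 * v) exactly-s) (scale (9 * v) exactly-t))))
    where
    scale : ∀ {n Q} a (e : Exactly n {#classes} Q) → ∑[ c < #classes ] (a * [ lookup (proj₁ e) c ]) ≡ a * n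
    scale a (S , refl , _) = trans (sym (*-distribˡ-sum a (λ c → [ lookup S c ]))) (cong (a *_) (∑-lookup S))

  -- After multiplication by v, both sides are six times the number of ordered pairs of vertices;
  -- the summand 6 on the left accounts for the diagonal.
  degree-equation : 6 * r + 8 * s + 9 * t + 6 ≡ 6 * v
  degree-equation = *-cancelʳ-≡ _ _ v {{>-nonZero 0<v}} (begin
    (6 * r + 8 * s + 9 * t + 6) * v
      ≡⟨ p r s t v ⟩
    6 * v * r + (8 * v * s + 9 * v * t) + 6 * v
      ≡⟨ cong (_+ 6 * v) ∑-share ⟨
    ∑[ c < #classes ] share c + 6 * v
      ≡⟨ cong (_+ 6 * v) (trans (*-distribˡ-sum 6 weight) (sum-cong-≗ weight-share)) ⟨
    6 * (∑[ c < #classes ] weight c) + 6 * v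
      ≡⟨ *-distribˡ-+ 6 (∑[ c < #classes ] weight c) v ⟨
    6 * (∑[ c < #classes ] weight c + v)
      ≡⟨ cong (6 *_) (trans (cong (_+ v) ∑-weight) ∑-E#) ⟩
    6 * (v * v)
      ≡⟨ *-assoc 6 v v ⟨
    6 * v * v ∎)
    where
    open ≡-Reasoning
    p : ∀ r s t v → (6 * r + 8 * s + 9 * t + 6) * v ≡ 6 * v * r + (8 * v * s + 9 * v * t) + 6 * v
    p = solve-∀

data Kind : Set where
  two three four : Kind

size : Kind → ℕ
size two   = 2
size three = 3
size four  = 4

size-injective : ∀ κ λ′ → size κ ≡ size λ′ → κ ≡ λ′
size-injective two   two   _ = refl
size-injective three three _ = refl
size-injective four  four  _ = refl

_≟ᵏ_ : DecidableEquality Kind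
κ ≟ᵏ λ′ = map′ (size-injective κ λ′) (cong size) (size κ ≟ size λ′)

-- The blocks of the bundles

-- The six vertices above a node.
Fibre : Set
Fibre = Bool × Fin 3

×-≡-dec : ∀ {A B : Set} → DecidableEquality A → DecidableEquality B → DecidableEquality (A × B)
×-≡-dec _≟₁_ _≟₂_ (a , b) (c , d) = map′ (λ (p , q) → cong₂ _,_ p q) ,-injective ((a ≟₁ c) ×-dec (b ≟₂ d))

_≟ᶻ_ : DecidableEquality Fibre
_≟ᶻ_ = ×-≡-dec _≟ᵇ_ _≟ᶠ_

-- The colour of the node below a vertex, and the position of the vertex above it.
State : Set
State = Bool × Fibre

-- An edge leaving a vertex: which of the two moves of the bundle to apply to its
-- node, and the position reached above the new node.
Port : Set
Port = Bool × Fibre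

_≟ᵖ_ : DecidableEquality Port
_≟ᵖ_ = ×-≡-dec _≟ᵇ_ _≟ᶻ_

-- The local rule of a class of paths of a bundle: the number of a vertex on its
-- path, and the edges to the next and the previous vertex of the path.  At the
-- last vertex `up` is junk, and so is `down` at the first.
record Pattern : Set where
  field
    kind    : Kind
    pos     : State → Fin (size kind)
    up down : State → Port

-- The effect of the two moves on the colour of a node.
Twist : Set
Twist = Bool → Bool → Bool

step : Twist → State → Port → State
step τ (β , _) (μ , z) = τ μ β , z

back : State → Port → Port
back (_ , z) (μ , _) = μ , z

record Consistent (τ : Twist) (p : Pattern) : Set where
  constructor consistent
  open Pattern p
  field
    up-ok   : ∀ s → suc (toℕ (pos s)) < size kind →
              toℕ (pos (step τ s (up s))) ≡ suc (toℕ (pos s)) ×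
              down (step τ s (up s)) ≡ back s (up s)
    down-ok : ∀ s → 0 < toℕ (pos s) →
              suc (toℕ (pos (step τ s (down s)))) ≡ toℕ (pos s) ×
              up (step τ s (down s)) ≡ back s (down s)

-- The test on the position discards the junk value of `up` at last vertices.
link : Pattern → State → Port → ℕ
link p s q = [ does (suc (toℕ (pos s)) <? size kind) ∧ does (up s ≟ᵖ q) ]
  where open Pattern p

-- A `link` records an edge only at its earlier end, so the edge is looked for from both ends.
links : Twist → Pattern → State → Port → ℕ
links τ p s q = link p s q + link p (step τ s q) (back s q)

Covers : Twist → (State → Port → ℕ) → List Pattern → Set
Covers τ w ps = ∀ s q → sumᴸ (map (λ p → links τ p s q) ps) ≡ w s q

allBool? : ∀ {P : Bool → Set} → (∀ b → Dec (P b)) → Dec (∀ b → P b)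
allBool? P? = map′ (λ (f , t) → λ { false → f ; true → t }) (λ h → h false , h true)
                   (P? false ×-dec P? true)

allState? : ∀ {P : State → Set} → (∀ s → Dec (P s)) → Dec (∀ s → P s)
allState? P? = map′ (λ h (b , e , c) → h b e c) (λ h b e c → h (b , e , c))
  (allBool? λ b → allBool? λ e → all? λ c → P? (b , e , c))

consistent? : ∀ τ p → Dec (Consistent τ p)
consistent? τ p = map′ (λ (u , d) → consistent u d) (λ (consistent u d) → u , d)
  ((allState? λ s → (_ <? _) →-dec ((_ ≟ _) ×-dec (_ ≟ᵖ _)))
  ×-dec (allState? λ s → (_ <? _) →-dec ((_ ≟ _) ×-dec (_ ≟ᵖ _))))

covers? : ∀ τ w ps → Dec (Covers τ w ps)
covers? τ w ps = allState? λ s → allState? λ q → _ ≟ _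

infixl 6 _⊕_ _⊖_
_⊕_ : Fin 3 → Fin 3 → Fin 3
0F ⊕ c  = c
1F ⊕ 0F = 1F
1F ⊕ 1F = 2F
1F ⊕ 2F = 0F
2F ⊕ 0F = 2F
2F ⊕ 1F = 0F
2F ⊕ 2F = 1F

⊝_ : Fin 3 → Fin 3
⊝ 0F = 0F
⊝ 1F = 2F
⊝ 2F = 1F

_⊖_ : Fin 3 → Fin 3 → Fin 3
a ⊖ b = a ⊕ (⊝ b)

Mate : Set
Mate = State → Port

-- A Mate describes a 1-factor.  In the next two definitions ω orders the two ends
-- of each of its edges.
pairs : Mate → (State → Bool) → Pattern
pairs m ω = record
  { kind = two
  ; pos  = λ s → if ω s then 0F else 1F
  ; up   = m
  ; down = m
  }

-- Paths with edges n, m, n, where m preserves and n reverses membership in the set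
-- of inner vertices.
quads : Mate → Mate → (State → Bool) → (State → Bool) → Pattern
quads m n inner ω = record
  { kind = four
  ; pos  = λ s → if inner s then (if ω s then 2F else 1F) else (if ω s then 0F else 3F)
  ; up   = λ s → if inner s ∧ not (ω s) then m s else n s
  ; down = λ s → if inner s ∧ ω s then m s else n s
  }

-- Paths along which the colour `col` decreases by one, with centres of colour κ; the
-- Boolean tells the second edge of a path from the first.
triples : (State → Fin 3) → (later : Bool → Mate) → (earlier : Bool → Mate) → Fin 3 → Pattern
triples col later earlier κ = record
  { kind = three
  ; pos  = place
  ; up   = λ s → later (does (place s ≟ᶠ 1F)) s
  ; down = λ s → earlier (does (place s ≟ᶠ 2F)) s
  }
  where
  place : State → Fin 3
  place s = κ ⊕ 1F ⊖ col s

-- The step from colour c to c - 1 is a first edge in the class with centres of colour c - 1 and a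
-- second edge in the class with centres of colour c. So the three classes use up both `later false`
-- and `later true`.
triad : (State → Fin 3) → (later : Bool → Mate) → (earlier : Bool → Mate) → List Pattern
triad col l e = triples col l e 0F ∷ triples col l e 1F ∷ triples col l e 2F ∷ []

-- Three 1-factors, such that m preserves and n₁, n₂ reverse membership in a set
-- `inner`.  Their union is also that of two classes of P₄s, one with its inner
-- vertices in the set and one with its inner vertices outside.
record Cubic : Set where
  field
    m n₁ n₂  : Mate
    inner    : State → Bool
    ω₁ ω₂    : State → Bool

asPaths : Cubic → List Pattern
asPaths C = quads m n₁ inner ω₁ ∷ quads m n₂ (not ∘ inner) ω₂ ∷ []
  where open Cubic C

asPairs : Cubic → List Pattern
asPairs C = pairs m ω₁ ∷ pairs n₁ ω₁ ∷ pairs n₂ ω₂ ∷ []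
  where open Cubic C

-- Each of the first y cubic graphs trades three classes of P₂s for two of P₄s.
mixed : ℕ → List Cubic → List Pattern
mixed _       []       = []
mixed zero    (C ∷ Cs) = asPairs C ++ mixed zero Cs
mixed (suc y) (C ∷ Cs) = asPaths C ++ mixed y Cs

-- The reflections c ↦ t - c are involutions, so the edge leads back by the same rule; as t varies
-- they exhaust the pairs of residues. A `shift` leads back by the opposite difference.
mirror : Bool → Bool → Fin 3 → Mate
mirror μ ε t (β , e , c) = μ , e xor ε , t ⊖ c

shift : Bool → Bool → Fin 3 → Mate
shift μ ε d (β , e , c) = μ , e xor ε , c ⊕ d

record Design : Set where
  field
    rigid  : List Pattern
    cubics : List Cubic

  resolve : ℕ → List Pattern
  resolve y = rigid ++ mixed y cubics

-- The twist of the bundles above F_(2J-1) ∪ F_2J.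
flipping : Twist
flipping _ = not

-- Direct the cycles.  The blow-up of a cycle consists of the edges with c′ - c = d,
-- for d mod 3.  In the colouring c + iβ the difference d = 1 - i(β′ - β) is a step
-- of +1, and for each arc these are distinct for i = 0, 1, 2.
triple-design : Design
triple-design = record { rigid = concat (map tri (0F ∷ 1F ∷ 2F ∷ [])) ; cubics = [] }
  where
  tri : Fin 3 → List Pattern
  tri i = triad
     (λ (β , e , c) → if β then c ⊕ i else c)
     (λ x (β , e , c) → not β , e xor x , (if β then c ⊕ i else c ⊖ i) ⊖ 1F)
     (λ x (β , e , c) → β , e xor x , (if β then c ⊕ i else c ⊖ i) ⊕ 1F)

-- For fixed `μ`, let `ε` take both values: then (ε, 0), (not ε, 1), (not ε, 2) run through all six
-- pairs of a difference in e and a sum c + c′, so the whole blow-up is covered. Both moves reverse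
-- β, so with the term ε ∧ β the set `inner` is preserved by `m` and reversed by `n₁` and `n₂`.
cubic-design : Design
cubic-design = record
  { rigid  = []
  ; cubics = cub false false ∷ cub false true ∷ cub true false ∷ cub true true ∷ []
  }
  where
  cub : Bool → Bool → Cubic
  cub μ ε = record
    { m     = mirror μ ε 0F
    ; n₁    = mirror μ (not ε) 1F
    ; n₂    = mirror μ (not ε) 2F
    ; inner = λ (β , e , c) → e xor (ε ∧ β)
    ; ω₁    = proj₁
    ; ω₂    = proj₁
    }

-- The twist of the bundle above F_0, whose first move is the identity.
central : Twist
central = _xor_

mirrorᵉ mirrorᵝ shiftᵝᵉ : Fin 3 → Mate
mirrorᵉ = mirror false true
mirrorᵝ = mirror true false
shiftᵝᵉ = shift true true

βˢ eˢ β+e : State → Bool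
βˢ (β , e , c) = β
eˢ (β , e , c) = e
β+e (β , e , c) = β xor e

-- K_12 as K_4[3] together with four triangles: (β , e) ranges over the vertices of
-- K_4, and hex κ, for the three values of κ, covers the triangles and the 1-factor
-- shiftᵝᵉ 0F.
hub₀ : Design
hub₀ = record
  { rigid  = pairs (hex 1F) (ωʰ eˢ 1F) ∷ pairs (hex 2F) (ωʰ eˢ 2F) ∷ []
  ; cubics = record { m = turn 1F ; n₁ = mirrorᵉ 1F ; n₂ = mirrorᵉ 2F ; inner = β+e ; ω₁ = eˢ ; ω₂ = eˢ }
           ∷ record { m = turn 2F ; n₁ = mirrorᵝ 1F ; n₂ = mirrorᵝ 2F ; inner = β+e ; ω₁ = βˢ ; ω₂ = βˢ }
           ∷ record { m = hex 0F ; n₁ = mirrorᵉ 0F ; n₂ = mirrorᵝ 0F ; inner = β+e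
                    ; ω₁ = ωʰ eˢ 0F ; ω₂ = ωʰ βˢ 0F }
           ∷ []
  }
  where
  -- The move reverses β, so the way back uses the opposite difference.
  turn : Fin 3 → Mate
  turn d s@(β , _) = shiftᵝᵉ (if β then ⊝ d else d) s

  -- The reflection in κ swaps the other two residues, which gives one edge of each triangle.
  hex : Fin 3 → Mate
  hex κ s@(β , e , c) = if does (c ≟ᶠ κ) then shiftᵝᵉ 0F s else (false , e , κ ⊕ κ ⊖ c)

  ωʰ : (State → Bool) → Fin 3 → State → Bool
  ωʰ ω κ s@(β , e , c) = if does (c ≟ᶠ κ) then ω s else does (c ≟ᶠ κ ⊕ 2F)

-- For each pair of opposite vertices of K_4 under shiftᵝᵉ, the K_6 above it without
-- the 1-factor shiftᵝᵉ 0F.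
octahedra : List Pattern
octahedra = triad (proj₂ ∘ proj₂)
  (λ x s@(β , e , c) → if x then (false , e , c ⊖ 1F) else shiftᵝᵉ 2F s)
  (λ x s@(β , e , c) → if x then (false , e , c ⊕ 1F) else shiftᵝᵉ 1F s)

-- Besides the octahedra and the 1-factor missing from them, K_12 has the edges above the four
-- remaining edges of K_4. These are the three mirrors in e and the three in β.
hub₁ : Design
hub₁ = record
  { rigid  = octahedra ++ pairs (shiftᵝᵉ 0F) βˢ ∷ []
  ; cubics = record { m = mirrorᵝ 0F ; n₁ = mirrorᵉ 1F ; n₂ = mirrorᵉ 2F ; inner = eˢ ; ω₁ = β+e ; ω₂ = β+e }
           ∷ record { m = mirrorᵉ 0F ; n₁ = mirrorᵝ 1F ; n₂ = mirrorᵝ 2F ; inner = βˢ ; ω₁ = β+e ; ω₂ = β+e }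
           ∷ []
  }

-- The second triad takes the differences ±1 above the four edges of K_4 that the octahedra avoid.
-- Left over are the edges that preserve c: three copies of K_4 in each K_12.
hub₂ : Design
hub₂ = record
  { rigid  = octahedra ++ triad (proj₂ ∘ proj₂)
               (λ x → if x then shift true false 2F else shift false true 2F)
               (λ x → if x then shift true false 1F else shift false true 1F)
  ; cubics = record { m = shiftᵝᵉ 0F ; n₁ = shift false true 0F ; n₂ = shift true false 0F
                    ; inner = β+e ; ω₁ = eˢ ; ω₂ = βˢ }
           ∷ []
  }

everywhere : State → Port → ℕ
everywhere _ _ = 1

-- Excludes the loops, which the identity move would produce.
elsewhere : State → Port → ℕ
elsewhere (_ , z) (μ , z′) = [ μ ∨ not (does (z ≟ᶻ z′)) ]

-- Finite verification of the designs

record Valid (τ : Twist) (w : State → Port → ℕ) (D : Design) (y : ℕ) : Set where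
  constructor valid
  field
    consistency : All (Consistent τ) (Design.resolve D y)
    coverage    : Covers τ w (Design.resolve D y)

valid? : ∀ τ w D y → Dec (Valid τ w D y)
valid? τ w D y = map′ (λ (c , v) → valid c v) (λ (valid c v) → c , v)
  (All? (consistent? τ) (Design.resolve D y) ×-dec covers? τ w (Design.resolve D y))

triple-valid : Valid flipping everywhere triple-design 0
triple-valid = toWitness {a? = valid? flipping everywhere triple-design 0} _

cubic-valid : ∀ (y : Fin 5) → Valid flipping everywhere cubic-design (toℕ y)
cubic-valid = toWitness {a? = all? λ y → valid? flipping everywhere cubic-design (toℕ y)} _

hub₀-valid : ∀ (y : Fin 4) → Valid central elsewhere hub₀ (toℕ y)
hub₀-valid = toWitness {a? = all? λ y → valid? central elsewhere hub₀ (toℕ y)} _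

hub₁-valid : ∀ (y : Fin 3) → Valid central elsewhere hub₁ (toℕ y)
hub₁-valid = toWitness {a? = all? λ y → valid? central elsewhere hub₁ (toℕ y)} _

hub₂-valid : ∀ (y : Fin 2) → Valid central elsewhere hub₂ (toℕ y)
hub₂-valid = toWitness {a? = all? λ y → valid? central elsewhere hub₂ (toℕ y)} _

-- Classes of paths

-- A partition of V into paths of the given kind, with the conventions of Pattern.
record Factor (V : Set) : Set where
  field
    kind     : Kind
    pos      : V → Fin (size kind)
    up down  : V → V

  HasNext : V → Set
  HasNext x = suc (toℕ (pos x)) < size kind

  HasPrevious : V → Set
  HasPrevious x = 0 < toℕ (pos x)

  field
    pos-up   : ∀ x → HasNext x → toℕ (pos (up x)) ≡ suc (toℕ (pos x))
    down-up  : ∀ x → HasNext x → down (up x) ≡ x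
    pos-down : ∀ x → HasPrevious x → suc (toℕ (pos (down x))) ≡ toℕ (pos x)
    up-down  : ∀ x → HasPrevious x → up (down x) ≡ x

  descend ascend : ℕ → V → V
  descend zero    x = x
  descend (suc i) x = descend i (down x)
  ascend zero    x = x
  ascend (suc i) x = up (ascend i x)

  -- A path is identified by its first vertex.
  root : V → V
  root x = descend (toℕ (pos x)) x

  root-up : ∀ x → HasNext x → root (up x) ≡ root x
  root-up x inner rewrite pos-up x inner | down-up x inner = refl

  pos-descend : ∀ i x → toℕ (pos x) ≡ i → toℕ (pos (descend i x)) ≡ 0
  pos-descend zero    x eq = eq
  pos-descend (suc i) x eq =
    pos-descend i (down x) (suc-injective (trans (pos-down x (subst (0 <_) (sym eq) z<s)) eq))

  pos-root : ∀ x → toℕ (pos (root x)) ≡ 0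
  pos-root x = pos-descend (toℕ (pos x)) x refl

  ascend-descend : ∀ i x → toℕ (pos x) ≡ i → ascend i (descend i x) ≡ x
  ascend-descend zero    x eq = refl
  ascend-descend (suc i) x eq =
    trans (cong up (ascend-descend i (down x) (suc-injective (trans (pos-down x late) eq)))) (up-down x late)
    where
    late : HasPrevious x
    late = subst (0 <_) (sym eq) z<s

  ascend-root : ∀ x → ascend (toℕ (pos x)) (root x) ≡ x
  ascend-root x = ascend-descend (toℕ (pos x)) x refl

  root-pos-injective : ∀ {x y} → root x ≡ root y → toℕ (pos x) ≡ toℕ (pos y) → x ≡ y
  root-pos-injective {x} {y} r p =
    trans (sym (ascend-root x)) (trans (cong₂ ascend p r) (ascend-root y))

  pos-ascend : ∀ {r} → toℕ (pos r) ≡ 0 → ∀ i → i < size kind → toℕ (pos (ascend i r)) ≡ i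
  pos-ascend r0 zero    i<k = r0
  pos-ascend {r} r0 (suc i) i<k = trans (pos-up _ (subst (λ p → suc p < size kind) (sym ih) i<k)) (cong suc ih)
    where
    ih = pos-ascend {r} r0 i (<-trans (n<1+n i) i<k)

  root-ascend : ∀ {r} → toℕ (pos r) ≡ 0 → ∀ i → i < size kind → root (ascend i r) ≡ r
  root-ascend {r} r0 zero    i<k = cong (λ i → descend i r) r0
  root-ascend {r} r0 (suc i) i<k =
    trans (root-up _ (subst (λ p → suc p < size kind) (sym (pos-ascend r0 i i<k′)) i<k)) (root-ascend r0 i i<k′)
    where
    i<k′ : i < size kind
    i<k′ = <-trans (n<1+n i) i<k

does⇒ : ∀ {A : Set} (a? : Dec A) → does a? ≡ true → A
does⇒ (yes a) _ = a

𝟙 : ∀ {A : Set} → Dec A → ℕ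
𝟙 a? = [ does a? ]

𝟙-yes : ∀ {A : Set} (a? : Dec A) → A → 𝟙 a? ≡ 1
𝟙-yes a? a = cong [_] (dec-true a? a)

𝟙-no : ∀ {A : Set} (a? : Dec A) → ¬ A → 𝟙 a? ≡ 0
𝟙-no a? ¬a = cong [_] (dec-false a? ¬a)

𝟙≢0⇒ : ∀ {A : Set} (a? : Dec A) → 𝟙 a? ≢ 0 → A
𝟙≢0⇒ (yes a) _ = a
𝟙≢0⇒ (no _) ≢0 = contradiction refl ≢0

module _ {V : Set} (_≟ⱽ_ : DecidableEquality V) where

  join? : ∀ F x y → Dec (Factor.HasNext F x × Factor.up F x ≡ y)
  join? F x y = (suc (toℕ (Factor.pos F x)) <? size (Factor.kind F)) ×-dec (Factor.up F x ≟ⱽ y)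

  join : Factor V → V → V → ℕ
  join F x y = 𝟙 (join? F x y)

  joins : Factor V → V → V → ℕ
  joins F x y = join F x y + join F y x

-- From lists of classes to resolvable designs

record Factorization (v : ℕ) : Set where
  field
    factors : List (Factor (Fin v))
    exact   : ∀ x y → x ≢ y → sumᴸ (map (λ F → joins _≟ᶠ_ F x y) factors) ≡ 1

tally : Kind → ∀ {V : Set} → List (Factor V) → ℕ
tally κ Fs = sumᴸ (map (λ F → [ does (Factor.kind F ≟ᵏ κ) ]) Fs)

∑-lookupᴸ : ∀ {A : Set} (f : A → ℕ) xs → ∑[ i < length xs ] f (lookupᴸ xs i) ≡ sumᴸ (map f xs)
∑-lookupᴸ f []       = refl
∑-lookupᴸ f (x ∷ xs) = cong (f x +_) (∑-lookupᴸ f xs)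

∑≡0⇒ : ∀ {n} (f : Fin n → ℕ) → ∑[ i < n ] f i ≡ 0 → ∀ i → f i ≡ 0
∑≡0⇒ f eq zero    = m+n≡0⇒m≡0 (f zero) eq
∑≡0⇒ f eq (suc i) = ∑≡0⇒ (f ∘ suc) (m+n≡0⇒n≡0 (f zero) eq) i

∑≡1⇒∃! : ∀ {n} (f : Fin n → ℕ) → ∑[ i < n ] f i ≡ 1 → ∃! _≡_ λ i → f i ≢ 0
∑≡1⇒∃! {suc n} f eq with f zero in f0
... | suc m = zero , (λ f≡0 → case trans (sym f0) f≡0 of λ ()) , unique
  where
  unique : ∀ {j} → f j ≢ 0 → zero ≡ j
  unique {zero}  _  = refl
  unique {suc j} fj = contradiction (∑≡0⇒ (f ∘ suc) (m+n≡0⇒n≡0 m (suc-injective eq)) j) fj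
... | zero with ∑≡1⇒∃! (f ∘ suc) eq
... | i , fi , unique′ = suc i , fi , unique
  where
  unique : ∀ {j} → f j ≢ 0 → suc i ≡ j
  unique {zero}  fj = contradiction f0 fj
  unique {suc j} fj = cong suc (unique′ fj)

∃!-↔ : ∀ {A B : Set} {P : A → Set} (i : A ↔ B) → ∃! _≡_ P → ∃! _≡_ (P ∘ Inverse.from i)
∃!-↔ {P = P} i (a , pa , unique) =
  to a , subst P (sym (strictlyInverseʳ a)) pa , λ pb → trans (cong to (unique pb)) (strictlyInverseˡ _)
  where open Inverse i

module _ {v : ℕ} (F : Factor (Fin v)) (r : Fin v) where
  open Factor F

  Edge : Fin v → Fin v → Set
  Edge x y = root x ≡ r × root y ≡ r × Adj (P (size kind)) (pos x) (pos y)

  vertex? : ∀ x → Dec (root x ≡ r)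
  vertex? x = root x ≟ᶠ r

  edge? : ∀ x y → Dec (Edge x y)
  edge? x y = vertex? x ×-dec vertex? y ×-dec
    (suc (toℕ (pos x)) ≟ toℕ (pos y) ⊎-dec suc (toℕ (pos y)) ≟ toℕ (pos x))

  path : Subgraph (K v)
  path = record
    { hasVertex = λ x → ⌊ vertex? x ⌋
    ; hasEdge   = λ x y → ⌊ edge? x y ⌋
    ; edge-sym  = λ {x} {y} e → let rx , ry , a = toWitness {a? = edge? x y} e in
                                fromWitness {a? = edge? y x} (ry , rx , swap a)
    ; edge-end  = λ {x} {y} e → fromWitness {a? = vertex? x} (proj₁ (toWitness {a? = edge? x y} e))
    ; edge-in-G = λ { {x} e refl → Graph.irreflexive (P (size kind)) {pos x}
                                     (proj₂ (proj₂ (toWitness {a? = edge? x x} e))) }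
    }

  -- The isomorphism reads off positions; its inverse climbs from r, which must therefore be a first
  -- vertex.
  path≅P : toℕ (pos r) ≡ 0 → asGraph path ≅ P (size kind)
  path≅P r0 = record
    { bijection = mk↔ₛ′ (λ (x , _) → pos x)
        (λ i → ascend (toℕ i) r , fromWitness {a? = vertex? _} (root-ascend r0 (toℕ i) (toℕ<n i)))
        (λ i → toℕ-injective (pos-ascend r0 (toℕ i) (toℕ<n i)))
        (λ (x , rx) → T-Σ-≡ (trans (cong (ascend (toℕ (pos x))) (sym (toWitness {a? = vertex? x} rx)))
                                   (ascend-root x)))
    ; adjacency = λ (x , rx) (y , ry) → mk⇔
        (λ e → proj₂ (proj₂ (toWitness {a? = edge? x y} e)))
        (λ a → fromWitness {a? = edge? x y}
                 (toWitness {a? = vertex? x} rx , toWitness {a? = vertex? y} ry , a))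
    }

module _ {v : ℕ} (F : Factor (Fin v)) where
  open Factor F

  join⇒ : ∀ x y → join _≟ᶠ_ F x y ≢ 0 → HasNext x × up x ≡ y
  join⇒ x y = 𝟙≢0⇒ (join? _≟ᶠ_ F x y)

  -- Both `up x` and y are the vertex after x on the same path, and root and position determine a
  -- vertex.
  ⇒join : ∀ x y → root x ≡ root y → suc (toℕ (pos x)) ≡ toℕ (pos y) → join _≟ᶠ_ F x y ≢ 0
  ⇒join x y rx≡ry px≡py j≡0 = case trans (sym j≡0) (𝟙-yes (join? _≟ᶠ_ F x y) (inner , up≡)) of λ ()
    where
    inner : HasNext x
    inner = subst (_< size kind) (sym px≡py) (toℕ<n (pos y))
    up≡ : up x ≡ y
    up≡ = root-pos-injective (trans (root-up x inner) rx≡ry) (trans (pos-up x inner) px≡py)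

  joins⇒ : ∀ x y → joins _≟ᶠ_ F x y ≢ 0 → Edge F (root x) x y
  joins⇒ x y j≢0 with join _≟ᶠ_ F x y in eq
  ... | suc _ = let inner , up≡ = join⇒ x y (λ j≡0 → case trans (sym eq) j≡0 of λ ()) in
    refl , trans (cong root (sym up≡)) (root-up x inner) ,
    inj₁ (trans (sym (pos-up x inner)) (cong (toℕ ∘ pos) up≡))
  ... | zero  = let inner , up≡ = join⇒ y x j≢0 in
    refl , trans (sym (root-up y inner)) (cong root up≡) ,
    inj₂ (trans (sym (pos-up y inner)) (cong (toℕ ∘ pos) up≡))

  ⇒joins : ∀ {r} x y → Edge F r x y → joins _≟ᶠ_ F x y ≢ 0
  ⇒joins x y (rx , ry , inj₁ eq) j≡0 =
    ⇒join x y (trans rx (sym ry)) eq (m+n≡0⇒m≡0 (join _≟ᶠ_ F x y) j≡0)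
  ⇒joins x y (rx , ry , inj₂ eq) j≡0 =
    ⇒join y x (trans ry (sym rx)) eq (m+n≡0⇒n≡0 (join _≟ᶠ_ F x y) j≡0)

module _ {v : ℕ} (0<v : 0 < v) (Fz : Factorization v) where
  open Factorization Fz
  open Factor using (kind; pos; root; pos-root)

  private
    F : Fin (length factors) → Factor (Fin v)
    F = lookupᴸ factors

    isRoot : Fin (length factors) → Fin v → Bool
    isRoot c r = ⌊ toℕ (pos (F c) r) ≟ 0 ⌋

    -- Indexing blocks by their first vertices lists every path of a class once.
    Block : Set
    Block = Σ[ c ∈ Fin (length factors) ] Σ[ r ∈ Fin v ] T (isRoot c r)

    subgraph : Block → Subgraph (K v)
    subgraph (c , r , _) = path (F c) r

    rooted : ∀ c x → T (isRoot c (root (F c) x))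
    rooted c x = fromWitness {a? = toℕ (pos (F c) (root (F c) x)) ≟ 0} (pos-root (F c) x)

    -- Only one class joins x and y, and within it the block can only be the one that starts at the
    -- root of x.
    edge-in-one : ∀ x y → x ≢ y → ∃! _≡_ λ (b : Block) → T (hasEdge (subgraph b) x y)
    edge-in-one x y x≢y
      with ∑≡1⇒∃! (λ c → joins _≟ᶠ_ (F c) x y) (trans (∑-lookupᴸ _ factors) (exact x y x≢y))
    ... | c , j , unique =
      (c , root (F c) x , rooted c x) , fromWitness {a? = edge? (F c) _ x y} (joins⇒ (F c) x y j) , same
      where
      same : ∀ {b} → T (hasEdge (subgraph b) x y) → (c , root (F c) x , rooted c x) ≡ b
      same {c′ , r , _} e with toWitness {a? = edge? (F c′) r x y} e
      ... | edge with unique (⇒joins (F c′) x y edge)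
      ... | refl = cong (c ,_) (T-Σ-≡ (proj₁ edge))

    vertex-in-one : ∀ c x → ∃! _≡_ λ (b : Block) → proj₁ b ≡ c × T (hasVertex (subgraph b) x)
    vertex-in-one c x =
      (c , root (F c) x , rooted c x) , (refl , fromWitness {a? = vertex? (F c) _ x} refl) , same
      where
      same : ∀ {b} → proj₁ b ≡ c × T (hasVertex (subgraph b) x) → (c , root (F c) x , rooted c x) ≡ b
      same {_ , r , _} (refl , rx) = cong (c ,_) (T-Σ-≡ (toWitness {a? = vertex? (F c) r x} rx))

    index : Block ↔ Fin (∑[ c < length factors ] ∑[ r < v ] [ isRoot c r ])
    index = ΣΣT↔Fin isRoot

    subgraph≅ : ∀ b → asGraph (subgraph b) ≅ P (size (kind (F (proj₁ b))))
    subgraph≅ (c , r , r0) = path≅P (F c) r (toWitness {a? = toℕ (pos (F c) r) ≟ 0} r0)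

    OfOrder : ℕ → Fin (length factors) → Set
    OfOrder k c = ∀ b → proj₁ (Inverse.from index b) ≡ c → asGraph (subgraph (Inverse.from index b)) ≅ P k

    of-kind : ∀ c → OfOrder (size (kind (F c))) c
    of-kind c b refl = subgraph≅ (Inverse.from index b)

    -- The block through the vertex 0 shows the class to be nonempty, and its order determines the
    -- kind.
    kind-unique : ∀ c κ → OfOrder (size κ) c → kind (F c) ≡ κ
    kind-unique c κ ofP = at (∃!-↔ index (vertex-in-one c (fromℕ< 0<v)))
      where
      at : ∃! _≡_ (λ b → proj₁ (Inverse.from index b) ≡ c ×
                         T (hasVertex (subgraph (Inverse.from index b)) (fromℕ< 0<v))) →
           kind (F c) ≡ κ
      at (b , (b∈c , _) , _) = size-injective (kind (F c)) κ (P-unique (of-kind c b b∈c) (ofP b b∈c))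

    exactly : ∀ κ → Exactly (tally κ factors) (OfOrder (size κ))
    exactly κ = S , cardinality , member⇔
      where
      ofKind : Fin (length factors) → Bool
      ofKind c = does (kind (F c) ≟ᵏ κ)
      S : Subset (length factors)
      S = tabulate ofKind
      cardinality : ∣ S ∣ ≡ tally κ factors
      cardinality = trans (sym (∑-lookup S))
        (trans (sum-cong-≗ (λ c → cong [_] (lookup∘tabulate ofKind c))) (∑-lookupᴸ _ factors))
      member⇔ : ∀ c → c ∈ S ⇔ OfOrder (size κ) c
      member⇔ c = mk⇔ member⇒ ⇒member
        where
        member⇒ : c ∈ S → OfOrder (size κ) c
        member⇒ c∈S = subst (λ κ → OfOrder (size κ) c)
          (does⇒ (kind (F c) ≟ᵏ κ) (trans (sym (lookup∘tabulate ofKind c)) ([]=⇒lookup c∈S))) (of-kind c)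
        ⇒member : OfOrder (size κ) c → c ∈ S
        ⇒member ofP = lookup⇒[]= c S
          (trans (lookup∘tabulate ofKind c) (dec-true (kind (F c) ≟ᵏ κ) (kind-unique c κ ofP)))

    one-of-three : ∀ (Q : ℕ → Set) κ → Q (size κ) → Q 2 ⊎ Q 3 ⊎ Q 4
    one-of-three Q two   = inj₁
    one-of-three Q three = inj₂ ∘ inj₁
    one-of-three Q four  = inj₂ ∘ inj₂

  factorization⇒URD : URD v (tally two factors) (tally three factors) (tally four factors)
  factorization⇒URD = record
    { #blocks   = ∑[ c < length factors ] ∑[ r < v ] [ isRoot c r ]
    ; block     = subgraph ∘ Inverse.from index
    ; isPath    = λ b → one-of-three (λ k → asGraph (subgraph (Inverse.from index b)) ≅ P k)
                                     (kind (F (proj₁ (Inverse.from index b)))) (subgraph≅ (Inverse.from index b))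
    ; edges     = λ x y x≢y → ∃!-↔ index (edge-in-one x y x≢y)
    ; #classes  = length factors
    ; classOf   = proj₁ ∘ Inverse.from index
    ; parallel  = λ c x → ∃!-↔ index (vertex-in-one c x)
    ; exactly-r = exactly two
    ; exactly-s = exactly three
    ; exactly-t = exactly four
    ; no-other  = λ c → one-of-three (λ k → OfOrder k c) (kind (F c)) (of-kind c)
    }

-- Transport of classes along a bijection

relabel : ∀ {V W : Set} → V ↔ W → Factor V → Factor W
relabel V↔W F = record
  { kind     = kind
  ; pos      = pos ∘ from
  ; up       = to ∘ up ∘ from
  ; down     = to ∘ down ∘ from
  ; pos-up   = λ x i → trans (cong (toℕ ∘ pos) (strictlyInverseʳ _)) (pos-up (from x) i)
  ; down-up  = λ x i → trans (cong (to ∘ down) (strictlyInverseʳ _))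
                             (trans (cong to (down-up (from x) i)) (strictlyInverseˡ x))
  ; pos-down = λ x l → trans (cong (suc ∘ toℕ ∘ pos) (strictlyInverseʳ _)) (pos-down (from x) l)
  ; up-down  = λ x l → trans (cong (to ∘ up) (strictlyInverseʳ _))
                             (trans (cong to (up-down (from x) l)) (strictlyInverseˡ x))
  }
  where
  open Factor F
  open Inverse V↔W

module _ {V W : Set} (V↔W : V ↔ W) (_≟ⱽ_ : DecidableEquality V) (_≟ᵂ_ : DecidableEquality W) where
  open Inverse V↔W

  join-relabel : ∀ F x y → join _≟ᵂ_ (relabel V↔W F) x y ≡ join _≟ⱽ_ F (from x) (from y)
  join-relabel F x y = cong [_] (does-⇔ (mk⇔
    (λ (i , eq) → i , trans (sym (strictlyInverseʳ _)) (cong from eq))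
    (λ (i , eq) → i , trans (cong to eq) (strictlyInverseˡ y)))
    (join? _≟ᵂ_ (relabel V↔W F) x y) (join? _≟ⱽ_ F (from x) (from y)))

  sum-joins-relabel : ∀ Fs x y → sumᴸ (map (λ F → joins _≟ᵂ_ F x y) (map (relabel V↔W) Fs)) ≡
                                 sumᴸ (map (λ F → joins _≟ⱽ_ F (from x) (from y)) Fs)
  sum-joins-relabel []       x y = refl
  sum-joins-relabel (F ∷ Fs) x y =
    cong₂ _+_ (cong₂ _+_ (join-relabel F x y) (join-relabel F y x)) (sum-joins-relabel Fs x y)

  tally-relabel : ∀ κ Fs → tally κ (map (relabel V↔W) Fs) ≡ tally κ Fs
  tally-relabel κ []       = refl
  tally-relabel κ (F ∷ Fs) = cong (_ +_) (tally-relabel κ Fs)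

patternTally : Kind → List Pattern → ℕ
patternTally κ ps = sumᴸ (map (λ p → [ does (Pattern.kind p ≟ᵏ κ) ]) ps)

-- Spreading local rules over a bundle

-- All that a local rule may see of the graph on the nodes: two involutions, and a colouring that
-- they change in the manner of `τ`.
record Bundle (B : Set) (τ : Twist) : Set where
  field
    move       : Bool → B → B
    colour     : B → Bool
    involutive : ∀ μ b → move μ (move μ b) ≡ b
    recolour   : ∀ μ b → colour (move μ b) ≡ τ μ (colour b)

interchange : ∀ f g l₀ l₁ r₀ r₁ → (f * l₀ + g * l₁) + (f * r₀ + g * r₁) ≡ f * (l₀ + r₀) + g * (l₁ + r₁)
interchange = solve-∀

module Spreading {B : Set} {τ : Twist} (𝓑 : Bundle B τ) where
  open Bundle 𝓑

  Point : Set
  Point = B × Fibre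

  state : Point → State
  state (b , z) = colour b , z

  leave : Point → Port → Point
  leave (b , _) (μ , z) = move μ b , z

  state-leave : ∀ x q → state (leave x q) ≡ step τ (state x) q
  state-leave (b , _) (μ , z) = cong (_, z) (recolour μ b)

  leave-back : ∀ x q → leave (leave x q) (back (state x) q) ≡ x
  leave-back (b , z) (μ , _) = cong (_, z) (involutive μ b)

  spread : ∀ p → Consistent τ p → Factor Point
  spread p (consistent up-ok down-ok) = record
    { kind     = kind
    ; pos      = pos ∘ state
    ; up       = λ x → leave x (up (state x))
    ; down     = λ x → leave x (down (state x))
    ; pos-up   = λ x i → trans (cong (toℕ ∘ pos) (state-leave x _)) (proj₁ (up-ok (state x) i))
    ; down-up  = λ x i → trans
        (cong (leave (leave x (up (state x)))) (trans (cong down (state-leave x _)) (proj₂ (up-ok (state x) i))))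
        (leave-back x (up (state x)))
    ; pos-down = λ x l → trans (cong (suc ∘ toℕ ∘ pos) (state-leave x _)) (proj₁ (down-ok (state x) l))
    ; up-down  = λ x l → trans
        (cong (leave (leave x (down (state x)))) (trans (cong up (state-leave x _)) (proj₂ (down-ok (state x) l))))
        (leave-back x (down (state x)))
    }
    where open Pattern p

  spreads : ∀ ps → All (Consistent τ) ps → List (Factor Point)
  spreads []       []       = []
  spreads (p ∷ ps) (c ∷ cs) = spread p c ∷ spreads ps cs

  module _ (_≟ᴮ_ : DecidableEquality B) where

    _≟ᴾ_ : DecidableEquality Point
    _≟ᴾ_ = ×-≡-dec _≟ᴮ_ _≟ᶻ_

    along : Bool → B → B → ℕ
    along μ b b′ = 𝟙 (move μ b ≟ᴮ b′)

    along-sym : ∀ μ b b′ → along μ b b′ ≡ along μ b′ b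
    along-sym μ b b′ = cong [_] (does-⇔ (mk⇔ (flipped b b′) (flipped b′ b)) (move μ b ≟ᴮ b′) (move μ b′ ≟ᴮ b))
      where
      flipped : ∀ b b′ → move μ b ≡ b′ → move μ b′ ≡ b
      flipped b _ refl = involutive μ b

    -- The port `up` uses one of the two moves; the summand of the other vanishes.
    join-spread : ∀ p c b z b′ z′ → join _≟ᴾ_ (spread p c) (b , z) (b′ , z′) ≡
      along false b b′ * link p (colour b , z) (false , z′) + along true b b′ * link p (colour b , z) (true , z′)
    join-spread p (consistent _ _) b z b′ z′
      with does (suc (toℕ (Pattern.pos p (colour b , z))) <? size (Pattern.kind p)) | Pattern.up p (colour b , z)
    ... | false | _ , _ = sym (cong₂ _+_ (*-zeroʳ (along false b b′)) (*-zeroʳ (along true b b′)))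
    ... | true | false , z″ = begin
      [ does (move false b ≟ᴮ b′) ∧ does (z″ ≟ᶻ z′) ]
        ≡⟨ []-∧ (does (move false b ≟ᴮ b′)) _ ⟨
      along false b b′ * [ does (z″ ≟ᶻ z′) ]
        ≡⟨ +-identityʳ _ ⟨
      along false b b′ * [ does (z″ ≟ᶻ z′) ] + 0
        ≡⟨ cong (along false b b′ * [ does (z″ ≟ᶻ z′) ] +_) (*-zeroʳ (along true b b′)) ⟨
      along false b b′ * [ does (z″ ≟ᶻ z′) ] + along true b b′ * 0 ∎
      where open ≡-Reasoning
    ... | true | true , z″ = begin
      [ does (move true b ≟ᴮ b′) ∧ does (z″ ≟ᶻ z′) ]
        ≡⟨ []-∧ (does (move true b ≟ᴮ b′)) _ ⟨
      along true b b′ * [ does (z″ ≟ᶻ z′) ]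
        ≡⟨ cong (_+ along true b b′ * [ does (z″ ≟ᶻ z′) ]) (*-zeroʳ (along false b b′)) ⟨
      along false b b′ * 0 + along true b b′ * [ does (z″ ≟ᶻ z′) ] ∎
      where open ≡-Reasoning

    -- Unless both sides vanish, b′ is the image of b under the move, and its colour is given by
    -- `τ`. This expresses the way back in terms of the state at b.
    link-return : ∀ p μ b b′ z z′ →
      along μ b′ b * link p (colour b′ , z′) (μ , z) ≡ along μ b b′ * link p (τ μ (colour b) , z′) (μ , z)
    link-return p μ b b′ z z′ rewrite along-sym μ b′ b with move μ b ≟ᴮ b′
    ... | yes refl rewrite recolour μ b = refl
    ... | no _     = refl

    joins-spread : ∀ p c b z b′ z′ → joins _≟ᴾ_ (spread p c) (b , z) (b′ , z′) ≡
      along false b b′ * links τ p (colour b , z) (false , z′) + along true b b′ * links τ p (colour b , z) (true , z′)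
    joins-spread p c b z b′ z′ = begin
      join _≟ᴾ_ (spread p c) (b , z) (b′ , z′) + join _≟ᴾ_ (spread p c) (b′ , z′) (b , z)
        ≡⟨ cong₂ _+_ (join-spread p c b z b′ z′) (trans (join-spread p c b′ z′ b z)
             (cong₂ _+_ (link-return p false b b′ z z′) (link-return p true b b′ z z′))) ⟩
      (f * l₀ + g * l₁) + (f * r₀ + g * r₁)
        ≡⟨ interchange f g l₀ l₁ r₀ r₁ ⟩
      f * (l₀ + r₀) + g * (l₁ + r₁) ∎
      where
      open ≡-Reasoning
      f g l₀ l₁ r₀ r₁ : ℕ
      f = along false b b′
      g = along true b b′
      l₀ = link p (colour b , z) (false , z′)
      l₁ = link p (colour b , z) (true , z′)
      r₀ = link p (τ false (colour b) , z′) (false , z)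
      r₁ = link p (τ true (colour b) , z′) (true , z)

    sum-joins-spreads : ∀ ps cs b z b′ z′ → sumᴸ (map (λ F → joins _≟ᴾ_ F (b , z) (b′ , z′)) (spreads ps cs)) ≡
      along false b b′ * sumᴸ (map (λ p → links τ p (colour b , z) (false , z′)) ps) +
      along true b b′ * sumᴸ (map (λ p → links τ p (colour b , z) (true , z′)) ps)
    sum-joins-spreads [] [] b z b′ z′ = sym (cong₂ _+_ (*-zeroʳ (along false b b′)) (*-zeroʳ (along true b b′)))
    sum-joins-spreads (p ∷ ps) (c ∷ cs) b z b′ z′ = trans
      (cong₂ _+_ (joins-spread p c b z b′ z′) (sum-joins-spreads ps cs b z b′ z′))
      (interchange (along false b b′) (along true b b′) (links τ p _ _) (links τ p _ _) _ _)

    sum-joins-covers : ∀ {w} ps cs → Covers τ w ps → ∀ b z b′ z′ →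
      sumᴸ (map (λ F → joins _≟ᴾ_ F (b , z) (b′ , z′)) (spreads ps cs)) ≡
      along false b b′ * w (colour b , z) (false , z′) + along true b b′ * w (colour b , z) (true , z′)
    sum-joins-covers ps cs cov b z b′ z′ = trans (sum-joins-spreads ps cs b z b′ z′)
      (cong₂ (λ l r → along false b b′ * l + along true b b′ * r) (cov _ _) (cov _ _))

  tally-spreads : ∀ κ ps cs → tally κ (spreads ps cs) ≡ patternTally κ ps
  tally-spreads κ []       []       = refl
  tally-spreads κ (p ∷ ps) (c ∷ cs) = cong (_ +_) (tally-spreads κ ps cs)

-- The 1-factorization of K_2k
halve-< : ∀ {x y} → x + x < y + y → x < y
halve-< {x} {y} lt = ≰⇒> λ y≤x → <⇒≱ lt (+-mono-≤ y≤x y≤x)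

halve-≤ : ∀ {x y} → x + x ≤ suc (y + y) → x ≤ y
halve-≤ {x} {y} le = ≮⇒≥ λ y<x → <⇒≱ (s≤s ≤-refl) (≤-trans
  (subst (_≤ x + x) (cong suc (+-suc y y)) (+-mono-≤ y<x y<x)) le)

double-injective : ∀ {x y} → x + x ≡ y + y → x ≡ y
double-injective eq =
  ≤-antisym (halve-≤ (m≤n⇒m≤1+n (≤-reflexive eq))) (halve-≤ (m≤n⇒m≤1+n (≤-reflexive (sym eq))))

half : ∀ i → ∃[ j ] (i ≡ j + j ⊎ i ≡ suc (j + j))
half zero    = 0 , inj₁ refl
half (suc i) with half i
... | j , inj₁ refl = j , inj₂ refl
... | j , inj₂ refl = suc j , inj₁ (cong suc (sym (+-suc j j)))

even≢odd-sum : ∀ x y h → x + x ≢ y + y + suc (h + h)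
even≢odd-sum x y h eq = even≢odd x (y + h) (trans (p x) (trans eq (q y h)))
  where
  p : ∀ x → 2 * x ≡ x + x
  p = solve-∀
  q : ∀ y h → y + y + suc (h + h) ≡ suc (2 * (y + h))
  q = solve-∀

module OneFactors (h : ℕ) where
  -- For k = h + 1 this is the modulus 2k - 1. That it is odd makes doubling a bijection on
  -- residues.
  n : ℕ
  n = suc (h + h)

  Node : Set
  Node = Fin (suc n)

  -- x + y ≡ i modulo n, for residues x, y and i
  Meet : ℕ → ℕ → ℕ → Set
  Meet i x y = x + y ≡ i ⊎ x + y ≡ i + n

  meet-sym : ∀ {i} x y → Meet i x y → Meet i y x
  meet-sym {i} x y = subst (λ s → s ≡ i ⊎ s ≡ i + n) (+-comm x y)

  overshoot : ∀ {x y z} → z < n → ¬ x + z ≡ x + y + n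
  overshoot {x} {y} {z} z<n eq = <⇒≱ z<n
    (subst (n ≤_) (sym (+-cancelˡ-≡ x z (y + n) (trans eq (+-assoc x y n)))) (m≤n+m n y))

  meet-cancel : ∀ {i} x {y z} → y < n → z < n → Meet i x y → Meet i x z → y ≡ z
  meet-cancel x y<n z<n (inj₁ p) (inj₁ q) = +-cancelˡ-≡ x _ _ (trans p (sym q))
  meet-cancel x y<n z<n (inj₂ p) (inj₂ q) = +-cancelˡ-≡ x _ _ (trans p (sym q))
  meet-cancel x y<n z<n (inj₁ refl) (inj₂ q) = contradiction q (overshoot z<n)
  meet-cancel x y<n z<n (inj₂ p) (inj₁ refl) = contradiction p (overshoot y<n)

  meet-index : ∀ {i j x y} → i < n → j < n → Meet i x y → Meet j x y → i ≡ j
  meet-index i<n j<n (inj₁ p) (inj₁ q) = trans (sym p) q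
  meet-index i<n j<n (inj₂ p) (inj₂ q) = +-cancelʳ-≡ n _ _ (trans (sym p) q)
  meet-index {i} {j} i<n j<n (inj₁ p) (inj₂ q) =
    contradiction (subst (n ≤_) (trans (sym q) p) (m≤n+m n j)) (<⇒≱ i<n)
  meet-index {i} {j} i<n j<n (inj₂ p) (inj₁ q) =
    contradiction (subst (n ≤_) (trans (sym p) q) (m≤n+m n i)) (<⇒≱ j<n)

  -- Two doubles cannot differ by the odd number n.
  meet-double : ∀ {i x y} → Meet i x x → Meet i y y → x ≡ y
  meet-double {x = x} {y} (inj₁ p) (inj₁ q) = double-injective (trans p (sym q))
  meet-double {x = x} {y} (inj₂ p) (inj₂ q) = double-injective (trans p (sym q))
  meet-double {x = x} {y} (inj₁ refl) (inj₂ q) = contradiction q (even≢odd-sum y x h)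
  meet-double {x = x} {y} (inj₂ p) (inj₁ refl) = contradiction p (even≢odd-sum x y h)

  meet-second : ∀ i x → i < n → x < n → ∃[ y ] y < n × Meet i x y
  meet-second i x i<n x<n with x ≤? i
  ... | yes x≤i = i ∸ x , ≤-<-trans (m∸n≤m i x) i<n , inj₁ (m+[n∸m]≡n x≤i)
  ... | no  x≰i = i + n ∸ x , +-cancelˡ-< x _ _ (subst (_< x + n) (sym sum≡) (+-monoˡ-< n (≰⇒> x≰i))) , inj₂ sum≡
    where
    sum≡ : x + (i + n ∸ x) ≡ i + n
    sum≡ = m+[n∸m]≡n (≤-trans (<⇒≤ x<n) (m≤n+m n i))

  meet-sum : ∀ x y → x < n → y < n → ∃[ i ] i < n × Meet i x y
  meet-sum x y x<n y<n with x + y <? n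
  ... | yes s<n = x + y , s<n , inj₁ refl
  ... | no  s≮n = x + y ∸ n , +-cancelʳ-< n _ _ (subst (_< n + n) (sym sum≡) (+-mono-< x<n y<n)) , inj₂ (sym sum≡)
    where
    sum≡ : x + y ∸ n + n ≡ x + y
    sum≡ = m∸n+n≡m (≮⇒≥ s≮n)

  meet-half : ∀ i → i < n → ∃[ x ] x < n × Meet i x x
  meet-half i i<n with half i
  ... | j , inj₁ refl = j , ≤-<-trans (m≤m+n j j) i<n , inj₁ refl
  -- For odd i the half is (i + n) / 2, with i = 2j + 1 and n = 2h + 1.
  ... | j , inj₂ refl = suc j + h , s≤s (+-monoˡ-≤ h (halve-< (s≤s⁻¹ i<n))) , inj₂ (p j h)
    where
    p : ∀ j h → suc j + h + (suc j + h) ≡ suc (j + j) + suc (h + h)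
    p = solve-∀

  -- zero is the point at infinity, and suc x the residue x.
  Paired : ℕ → Node → Node → Set
  Paired i zero    zero    = ⊥
  Paired i zero    (suc y) = Meet i (toℕ y) (toℕ y)
  Paired i (suc x) zero    = Meet i (toℕ x) (toℕ x)
  Paired i (suc x) (suc y) = x ≢ y × Meet i (toℕ x) (toℕ y)

  paired-sym : ∀ {i} b b′ → Paired i b b′ → Paired i b′ b
  paired-sym zero    (suc _) m = m
  paired-sym (suc _) zero    m = m
  paired-sym (suc x) (suc y) (x≢y , m) = x≢y ∘ sym , meet-sym (toℕ x) (toℕ y) m

  paired-irrefl : ∀ {i} b → ¬ Paired i b b
  paired-irrefl (suc x) (x≢x , _) = x≢x refl

  paired-unique : ∀ {i} b b′ b″ → Paired i b b′ → Paired i b b″ → b′ ≡ b″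
  paired-unique zero    (suc y) (suc z) m m′ = cong suc (toℕ-injective (meet-double m m′))
  paired-unique (suc x) zero    zero    m m′ = refl
  paired-unique (suc x) zero    (suc z) m (x≢z , m′) =
    contradiction (toℕ-injective (meet-cancel (toℕ x) (toℕ<n x) (toℕ<n z) m m′)) x≢z
  paired-unique (suc x) (suc y) zero    (x≢y , m) m′ =
    contradiction (toℕ-injective (meet-cancel (toℕ x) (toℕ<n x) (toℕ<n y) m′ m)) x≢y
  paired-unique (suc x) (suc y) (suc z) (_ , m) (_ , m′) =
    cong suc (toℕ-injective (meet-cancel (toℕ x) (toℕ<n y) (toℕ<n z) m m′))

  paired-index : ∀ {i j} b b′ → i < n → j < n → Paired i b b′ → Paired j b b′ → i ≡ j
  paired-index zero    (suc y) i<n j<n m m′ = meet-index {x = toℕ y} {toℕ y} i<n j<n m m′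
  paired-index (suc x) zero    i<n j<n m m′ = meet-index {x = toℕ x} {toℕ x} i<n j<n m m′
  paired-index (suc x) (suc y) i<n j<n (_ , m) (_ , m′) = meet-index {x = toℕ x} {toℕ y} i<n j<n m m′

  -- A residue x is matched with i - x, or with ∞ if i - x is x itself; so ∞ is matched with the
  -- half of i.
  paired-exists : ∀ {i} → i < n → ∀ b → ∃[ b′ ] Paired i b b′
  paired-exists {i} i<n zero with meet-half i i<n
  ... | x , x<n , m = suc (fromℕ< x<n) , subst (λ x → Meet i x x) (sym (toℕ-fromℕ< x<n)) m
  paired-exists {i} i<n (suc x) with meet-second i (toℕ x) i<n (toℕ<n x)
  ... | y , y<n , m with toℕ x ≟ y
  ...   | yes refl = zero , m
  ...   | no  x≢y  = suc (fromℕ< y<n) ,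
    (λ x≡y → x≢y (trans (cong toℕ x≡y) (toℕ-fromℕ< y<n))) ,
    subst (Meet i (toℕ x)) (sym (toℕ-fromℕ< y<n)) m

  paired-covers : ∀ b b′ → b ≢ b′ → ∃[ i ] i < n × Paired i b b′
  paired-covers zero    zero    b≢b = contradiction refl b≢b
  paired-covers zero    (suc y) _   = meet-sum (toℕ y) (toℕ y) (toℕ<n y) (toℕ<n y)
  paired-covers (suc x) zero    _   = meet-sum (toℕ x) (toℕ x) (toℕ<n x) (toℕ<n x)
  paired-covers (suc x) (suc y) b≢b′ with meet-sum (toℕ x) (toℕ y) (toℕ<n x) (toℕ<n y)
  ... | i , i<n , m = i , i<n , b≢b′ ∘ cong suc , m

  partner : ∀ {i} → i < n → Node → Node
  partner i<n b = proj₁ (paired-exists i<n b)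

  partner-paired : ∀ {i} (i<n : i < n) b → Paired i b (partner i<n b)
  partner-paired i<n b = proj₂ (paired-exists i<n b)

  partner-involutive : ∀ {i} (i<n : i < n) b → partner i<n (partner i<n b) ≡ b
  partner-involutive i<n b =
    paired-unique (partner i<n b) _ _ (partner-paired i<n _) (paired-sym b _ (partner-paired i<n b))

  partner-self : ∀ {i} (i<n : i < n) b → 𝟙 (partner i<n b ≟ᶠ b) ≡ 0
  partner-self i<n b = 𝟙-no (partner i<n b ≟ᶠ b)
    λ eq → paired-irrefl b (subst (Paired _ b) eq (partner-paired i<n b))

  partner-index : ∀ {i j b b′} (i<n : i < n) (j<n : j < n) → Paired j b b′ →
                  𝟙 (partner i<n b ≟ᶠ b′) ≡ 𝟙 (i ≟ j)
  partner-index {i} {j} {b} {b′} i<n j<n m = cong [_] (does-⇔ (mk⇔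
    (λ eq → paired-index b b′ i<n j<n (subst (Paired i b) eq (partner-paired i<n b)) m)
    (λ { refl → paired-unique b _ _ (partner-paired i<n b) m })) (partner i<n b ≟ᶠ b′) (i ≟ j))

  -- i is 2J or 2J - 1; both F_(2J-1) and F_2J alternate between the k residues
  -- J, ..., J + k - 1 and the rest.
  Near : ℕ → ℕ → Set
  Near i J = i ≤ J + J × J + J ≤ suc i

  Within : ℕ → ℕ → Set
  Within J x = J ≤ x × x < J + suc h

  within? : ∀ J x → Dec (Within J x)
  within? J x = (J ≤? x) ×-dec (x <? J + suc h)

  tint : ℕ → Node → Bool
  tint J zero    = false
  tint J (suc x) = does (within? J (toℕ x))

  double-J+n : ∀ J → suc (J + J + n) ≡ J + suc h + (J + suc h)
  double-J+n J = p J h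
    where
    p : ∀ J h → suc (J + J + suc (h + h)) ≡ J + suc h + (J + suc h)
    p = solve-∀

  -- The residue matched with ∞ is J if i = 2J and J + h if i = 2J - 1, an end of the window in
  -- either case.
  within-fixed : ∀ {i J x} → J ≤ h → Near i J → Meet i x x → Within J x
  within-fixed {i} {J} J≤h (i≤ , ≤i) (inj₁ refl) =
    halve-≤ ≤i , ≤-<-trans (halve-≤ (m≤n⇒m≤1+n i≤)) (m<m+n J z<s)
  within-fixed {i} {J} {x} J≤h (i≤ , ≤i) (inj₂ eq) =
    halve-≤ (≤-trans (≤-trans ≤i (s≤s (m≤m+n i n))) (s≤s (≤-reflexive (sym eq)))) ,
    halve-< (≤-trans (s≤s (≤-trans (≤-reflexive eq) (+-monoˡ-≤ n i≤))) (≤-reflexive (double-J+n J)))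

  -- If x + y = i, then x lies below the mean i/2 ≤ J, hence below the window, while y is at least J
  -- and at most i ≤ 2J ≤ J + h. If x + y = i + n, then y exceeds (i + n)/2, hence the window, while
  -- x stays below J + h + 1 and is larger than i because y < n.
  apart : ∀ {i J x y} → J ≤ h → Near i J → x < y → y < n → Meet i x y →
          (¬ Within J x × Within J y) ⊎ (Within J x × ¬ Within J y)
  apart {i} {J} {x} {y} J≤h (i≤ , ≤i) x<y y<n (inj₁ refl) = inj₁
    ( (λ (J≤x , _) → <⇒≱ (halve-< (<-≤-trans (+-monoʳ-< x x<y) i≤)) J≤x)
    , halve-≤ (≤-trans ≤i (s≤s (<⇒≤ (+-monoˡ-< y x<y))))
    , ≤-<-trans (≤-trans (m≤n+m y x) i≤) (+-monoʳ-< J (s≤s J≤h)))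
  apart {i} {J} {x} {y} J≤h (i≤ , ≤i) x<y y<n (inj₂ eq) = inj₂
    ( ( ≤-trans (m≤m+n J J) (≤-trans ≤i (+-cancelʳ-≤ n _ _ (begin
          suc i + n   ≡⟨ cong suc eq ⟨
          suc x + y   ≡⟨ +-suc x y ⟨
          x + suc y   ≤⟨ +-monoʳ-≤ x y<n ⟩
          x + n       ∎)))
      , halve-< (begin-strict
          x + x       <⟨ +-monoʳ-< x x<y ⟩
          x + y       ≡⟨ eq ⟩
          i + n       ≤⟨ +-monoˡ-≤ n i≤ ⟩
          J + J + n   <⟨ ≤-refl ⟩
          suc (J + J + n) ≡⟨ double-J+n J ⟩
          J + suc h + (J + suc h) ∎))
    , λ (_ , y<J+k) → <⇒≱ y<J+k (halve-≤ (begin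
          J + suc h + (J + suc h) ≡⟨ double-J+n J ⟨
          suc (J + J + n)         ≤⟨ s≤s (+-monoˡ-≤ n ≤i) ⟩
          suc (suc i + n)         ≡⟨ cong 2+ eq ⟨
          suc (suc (x + y))       ≤⟨ s≤s (+-monoˡ-< y x<y) ⟩
          suc (y + y)             ∎)))
    where open ≤-Reasoning

  tint-paired : ∀ {i J} → J ≤ h → Near i J → ∀ b b′ → Paired i b b′ → tint J b′ ≡ not (tint J b)
  tint-paired {J = J} J≤h near zero (suc y) m = dec-true (within? J (toℕ y)) (within-fixed J≤h near m)
  tint-paired {J = J} J≤h near (suc x) zero m = cong not (sym (dec-true (within? J (toℕ x)) (within-fixed J≤h near m)))
  tint-paired {i} {J} J≤h near (suc x) (suc y) (x≢y , m) =
    case ordered of λ where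
      (inj₁ x<y) → case apart J≤h near x<y (toℕ<n y) m of λ where
        (inj₁ (¬x , y∈)) → enters ¬x y∈
        (inj₂ (x∈ , ¬y)) → leaves x∈ ¬y
      (inj₂ y<x) → case apart J≤h near y<x (toℕ<n x) (meet-sym (toℕ x) (toℕ y) m) of λ where
        (inj₁ (¬y , x∈)) → leaves x∈ ¬y
        (inj₂ (y∈ , ¬x)) → enters ¬x y∈
    where
    ordered : toℕ x < toℕ y ⊎ toℕ y < toℕ x
    ordered with <-cmp (toℕ x) (toℕ y)
    ... | tri< x<y _ _ = inj₁ x<y
    ... | tri≈ _ x≡y _ = contradiction (toℕ-injective x≡y) x≢y
    ... | tri> _ _ y<x = inj₂ y<x
    enters : ¬ Within J (toℕ x) → Within J (toℕ y) → tint J (suc y) ≡ not (tint J (suc x))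
    enters ¬x y∈ rewrite dec-false (within? J (toℕ x)) ¬x = dec-true (within? J (toℕ y)) y∈
    leaves : Within J (toℕ x) → ¬ Within J (toℕ y) → tint J (suc y) ≡ not (tint J (suc x))
    leaves x∈ ¬y rewrite dec-true (within? J (toℕ x)) x∈ = dec-false (within? J (toℕ y)) ¬y

  0<n : 0 < n
  0<n = z<s

  hub : Bundle Node central
  hub = record
    { move       = λ μ b → if μ then partner 0<n b else b
    ; colour     = tint 0
    ; involutive = λ { false b → refl ; true b → partner-involutive 0<n b }
    ; recolour   = λ { false b → refl
                     ; true b → tint-paired z≤n (z≤n , z≤n) b _ (partner-paired 0<n b) }
    }

  odd<n : (j : Fin h) → suc (toℕ j + toℕ j) < n
  odd<n j = s≤s (+-mono-<-≤ (toℕ<n j) (<⇒≤ (toℕ<n j)))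

  even<n : (j : Fin h) → suc (suc (toℕ j + toℕ j)) < n
  even<n j = s≤s (subst (_≤ h + h) (cong suc (+-suc (toℕ j) (toℕ j))) (+-mono-≤ (toℕ<n j) (toℕ<n j)))

  -- With J = j + 1, these are the matchings F_(2J-1) and F_2J.
  cycle-move : Fin h → Bool → Node → Node
  cycle-move j false = partner (odd<n j)
  cycle-move j true  = partner (even<n j)

  cycle : Fin h → Bundle Node flipping
  cycle j = record
    { move       = cycle-move j
    ; colour     = tint (suc (toℕ j))
    ; involutive = λ { false → partner-involutive (odd<n j) ; true → partner-involutive (even<n j) }
    ; recolour   = λ { false b → tint-paired (toℕ<n j) odd-near b _ (partner-paired (odd<n j) b)
                     ; true  b → tint-paired (toℕ<n j) even-near b _ (partner-paired (even<n j) b) }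
    }
    where
    2J : suc (toℕ j) + suc (toℕ j) ≡ suc (suc (toℕ j + toℕ j))
    2J = cong suc (+-suc (toℕ j) (toℕ j))
    odd-near : Near (suc (toℕ j + toℕ j)) (suc (toℕ j))
    odd-near = ≤-trans (n≤1+n _) (≤-reflexive (sym 2J)) , ≤-reflexive 2J
    even-near : Near (suc (suc (toℕ j + toℕ j))) (suc (toℕ j))
    even-near = ≤-reflexive (sym 2J) , m≤n⇒m≤1+n (≤-reflexive 2J)

  private
    -- The numbers 0, 2j + 1, 2j + 2 for j < m list 0, ..., 2m once each. When m drops by one and i
    -- by two, the summand of j = 0 becomes the leading indicator.
    pick : ∀ m i → i < suc (m + m) →
      𝟙 (0 ≟ i) + ∑[ j < m ] (𝟙 (suc (toℕ j + toℕ j) ≟ i) + 𝟙 (suc (suc (toℕ j + toℕ j)) ≟ i)) ≡ 1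
    pick zero    zero    _ = refl
    pick zero    (suc i) (s≤s ())
    pick (suc m) zero    _ = cong suc (∑-zeros {m} _ λ j → refl)
    pick (suc m) (suc zero) _ = cong suc (∑-zeros {m} _ λ j → cong₂ _+_ (late j) refl)
      where
      late : ∀ (j : Fin m) → 𝟙 (suc (suc (toℕ j) + suc (toℕ j)) ≟ 1) ≡ 0
      late j = refl
    pick (suc m) (suc (suc i)) lt = trans
      (cong (𝟙 (0 ≟ i) +_) (sum-cong-≗ {m} (λ j → cong₂ _+_
        (cong (λ s → 𝟙 (s ≟ i)) (+-suc (toℕ j) (toℕ j)))
        (cong (λ s → 𝟙 (suc s ≟ i)) (+-suc (toℕ j) (toℕ j))))))
      (pick m i (s≤s⁻¹ (s≤s⁻¹ (subst (suc (suc i) <_) (cong 2+ (+-suc m m)) lt))))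

  open Bundle

  tours : Node → Node → ℕ
  tours b b′ = 𝟙 (partner 0<n b ≟ᶠ b′) +
    ∑[ j < h ] (𝟙 (cycle-move j false b ≟ᶠ b′) + 𝟙 (cycle-move j true b ≟ᶠ b′))

  tours-distinct : ∀ b b′ → b ≢ b′ → tours b b′ ≡ 1
  tours-distinct b b′ b≢b′ with paired-covers b b′ b≢b′
  ... | i , i<n , m = trans (cong₂ _+_ (partner-index 0<n i<n m)
      (sum-cong-≗ (λ j → cong₂ _+_ (partner-index (odd<n j) i<n m) (partner-index (even<n j) i<n m))))
    (pick h i i<n)

  tours-self : ∀ b → tours b b ≡ 0
  tours-self b = cong₂ _+_ (partner-self 0<n b)
    (∑-zeros _ λ j → cong₂ _+_ (partner-self (odd<n j) b) (partner-self (even<n j) b))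

-- Assembling the bundles
record Resolution (τ : Twist) (w : State → Port → ℕ) : Set where
  constructor resolution
  field
    patterns    : List Pattern
    consistency : All (Consistent τ) patterns
    coverage    : Covers τ w patterns

resolveWith : ∀ {τ w} D y → Valid τ w D y → Resolution τ w
resolveWith D y (valid c v) = resolution (Design.resolve D y) c v

amount : ∀ {τ w} → Kind → Resolution τ w → ℕ
amount κ R = patternTally κ (Resolution.patterns R)

HubResolution : Set
HubResolution = Resolution central elsewhere

CycleResolution : Set
CycleResolution = Resolution flipping everywhere

sum-++-map : ∀ {A : Set} (f : A → ℕ) xs ys → sumᴸ (map f (xs ++ ys)) ≡ sumᴸ (map f xs) + sumᴸ (map f ys)
sum-++-map f xs ys = trans (cong sumᴸ (map-++ f xs ys)) (sum-++ (map f xs) (map f ys))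

sum-concat-tabulate : ∀ {A : Set} (f : A → ℕ) {n} (g : Fin n → List A) →
  sumᴸ (map f (concat (tabulateᴸ g))) ≡ ∑[ j < n ] sumᴸ (map f (g j))
sum-concat-tabulate f {zero}  g = refl
sum-concat-tabulate f {suc n} g = trans (sum-++-map f (g zero) _)
  (cong (sumᴸ (map f (g zero)) +_) (sum-concat-tabulate f (g ∘ suc)))

module Assembly (h : ℕ) (ρ₀ : HubResolution) (ρ : Fin h → CycleResolution) where
  open OneFactors h
  open Bundle

  Point : Set
  Point = Node × Fibre

  hub-factors : List (Factor Point)
  hub-factors = Spreading.spreads hub (Resolution.patterns ρ₀) (Resolution.consistency ρ₀)

  cycle-factors : Fin h → List (Factor Point)
  cycle-factors j = Spreading.spreads (cycle j) (Resolution.patterns (ρ j)) (Resolution.consistency (ρ j))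

  all-factors : List (Factor Point)
  all-factors = hub-factors ++ concat (tabulateᴸ cycle-factors)

  _≟ⱽ_ = Spreading._≟ᴾ_ hub _≟ᶠ_

  total : Kind → ℕ
  total κ = amount κ ρ₀ + ∑[ j < h ] amount κ (ρ j)

  tally-all : ∀ κ → tally κ all-factors ≡ total κ
  tally-all κ = trans (sum-++-map _ hub-factors _)
    (cong₂ _+_ (Spreading.tally-spreads hub κ (Resolution.patterns ρ₀) (Resolution.consistency ρ₀))
      (trans (sum-concat-tabulate _ cycle-factors)
        (sum-cong-≗ λ j → Spreading.tally-spreads (cycle j) κ (Resolution.patterns (ρ j)) (Resolution.consistency (ρ j)))))

  -- The identity move of the hub accounts for the pairs above one node, and the partner moves for
  -- those above an edge of K_2k.
  sum-joins : ∀ b z b′ z′ → sumᴸ (map (λ F → joins _≟ⱽ_ F (b , z) (b′ , z′)) all-factors) ≡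
              𝟙 (b ≟ᶠ b′) * [ not (does (z ≟ᶻ z′)) ] + tours b b′
  sum-joins b z b′ z′ = trans (sum-++-map _ hub-factors _) (trans (cong₂ _+_
      (Spreading.sum-joins-covers hub _≟ᶠ_ (Resolution.patterns ρ₀) _ (Resolution.coverage ρ₀) b z b′ z′)
      (trans (sum-concat-tabulate _ cycle-factors) (sum-cong-≗ cycle-sum)))
    (regroup (𝟙 (b ≟ᶠ b′) * [ not (does (z ≟ᶻ z′)) ]) (𝟙 (partner 0<n b ≟ᶠ b′))
             (∑[ j < h ] (𝟙 (cycle-move j false b ≟ᶠ b′) + 𝟙 (cycle-move j true b ≟ᶠ b′)))))
    where
    cycle-sum : ∀ j → sumᴸ (map (λ F → joins _≟ⱽ_ F (b , z) (b′ , z′)) (cycle-factors j)) ≡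
                      𝟙 (cycle-move j false b ≟ᶠ b′) + 𝟙 (cycle-move j true b ≟ᶠ b′)
    cycle-sum j = trans
      (Spreading.sum-joins-covers (cycle j) _≟ᶠ_ (Resolution.patterns (ρ j)) _ (Resolution.coverage (ρ j)) b z b′ z′)
      (cong₂ _+_ (*-identityʳ (𝟙 (cycle-move j false b ≟ᶠ b′))) (*-identityʳ (𝟙 (cycle-move j true b ≟ᶠ b′))))
    regroup : ∀ p q s → p + q * 1 + s ≡ p + (q + s)
    regroup = solve-∀

  exact-once : ∀ x y → x ≢ y → sumᴸ (map (λ F → joins _≟ⱽ_ F x y) all-factors) ≡ 1
  exact-once (b , z) (b′ , z′) x≢y = trans (sum-joins b z b′ z′) once
    where
    once : 𝟙 (b ≟ᶠ b′) * [ not (does (z ≟ᶻ z′)) ] + tours b b′ ≡ 1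
    once with b ≟ᶠ b′
    ... | no  b≢b′ = tours-distinct b b′ b≢b′
    ... | yes refl = cong₂ (λ d t → 1 * [ not d ] + t)
      (dec-false (z ≟ᶻ z′) λ { refl → x≢y refl }) (tours-self b)

  order : ℕ
  order = suc n * (2 * 3)

  Point↔Fin : Point ↔ Fin order
  Point↔Fin = ↔-trans (↔-refl ×-↔ ↔-trans (↔-sym 2↔Bool ×-↔ ↔-refl) (↔-sym *↔×)) (↔-sym *↔×)

  factorization : Factorization order
  factorization = record
    { factors = map (relabel Point↔Fin) all-factors
    ; exact   = λ x y x≢y → trans (sum-joins-relabel Point↔Fin _≟ⱽ_ _≟ᶠ_ all-factors x y)
        (exact-once _ _ λ eq → x≢y (trans (sym (strictlyInverseˡ x)) (trans (cong to eq) (strictlyInverseˡ y))))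
    }
    where open Inverse Point↔Fin

  tally-factorization : ∀ κ → tally κ (Factorization.factors factorization) ≡ total κ
  tally-factorization κ = trans (tally-relabel Point↔Fin _≟ⱽ_ _≟ᶠ_ κ all-factors) (tally-all κ)

  assembled : URD (suc h * 12) (total two) (total three) (total four)
  assembled = subst (λ v → URD v (total two) (total three) (total four)) (order≡ h)
    (subst₂ (λ r (s , t) → URD order r s t) (tally-factorization two)
      (cong₂ _,_ (tally-factorization three) (tally-factorization four))
      (factorization⇒URD z<s factorization))
    where
    order≡ : ∀ h → suc (suc (h + h)) * (2 * 3) ≡ suc h * 12
    order≡ = solve-∀

-- Distributing the classes of P₃s and P₄s over the bundles

record Plan (h r s t : ℕ) : Set where
  constructor plan
  field
    inner : HubResolution
    outer : Fin h → CycleResolution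
    r≡    : Assembly.total h inner outer two ≡ r
    s≡    : Assembly.total h inner outer three ≡ s
    t≡    : Assembly.total h inner outer four ≡ t

plan⇒URD : ∀ {h r s t} → Plan h r s t → URD (suc h * 12) r s t
plan⇒URD (plan ρ₀ ρ refl refl refl) = Assembly.assembled _ ρ₀ ρ

lone : (R : HubResolution) → Plan 0 (amount two R) (amount three R) (amount four R)
lone R = plan R (λ ()) (+-identityʳ _) (+-identityʳ _) (+-identityʳ _)

-- A resolution is local data that fits every cycle bundle, so the old choices remain available when
-- the number of nodes changes.
extend : ∀ {h r s t} (R : CycleResolution) → Plan h r s t →
         Plan (suc h) (amount two R + r) (amount three R + s) (amount four R + t)
extend {h} R (plan ρ₀ ρ refl refl refl) = plan ρ₀ ρ⁺ (total≡ two) (total≡ three) (total≡ four)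
  where
  ρ⁺ : Fin (suc h) → CycleResolution
  ρ⁺ zero    = R
  ρ⁺ (suc j) = ρ j
  exchange : ∀ a b c → a + (b + c) ≡ b + (a + c)
  exchange = solve-∀
  total≡ : ∀ κ → amount κ ρ₀ + (amount κ R + ∑[ j < h ] amount κ (ρ j)) ≡
                 amount κ R + (amount κ ρ₀ + ∑[ j < h ] amount κ (ρ j))
  total≡ κ = exchange (amount κ ρ₀) (amount κ R) _

triple-cycle : CycleResolution
triple-cycle = resolveWith triple-design 0 triple-valid

cubic-cycle : Fin 5 → CycleResolution
cubic-cycle y = resolveWith cubic-design (toℕ y) (cubic-valid y)

cubic-amounts : ∀ y → amount two (cubic-cycle y) ≡ 12 ∸ 3 * toℕ y ×
                      amount three (cubic-cycle y) ≡ 0 × amount four (cubic-cycle y) ≡ 2 * toℕ y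
cubic-amounts 0F = refl , refl , refl
cubic-amounts 1F = refl , refl , refl
cubic-amounts 2F = refl , refl , refl
cubic-amounts 3F = refl , refl , refl
cubic-amounts 4F = refl , refl , refl

recast : ∀ {h r r′ s s′ t t′} → r ≡ r′ → s ≡ s′ → t ≡ t′ → Plan h r s t → Plan h r′ s′ t′
recast refl refl refl p = p

extend-cubic : ∀ {h r s t} y → y ≤ 4 → Plan h r s t → Plan (suc h) (12 ∸ 3 * y + r) s (2 * y + t)
extend-cubic {r = r} {s} {t} y y≤4 p =
  let r≡ , s≡ , t≡ = cubic-amounts y′
  in recast (cong (_+ r) (trans r≡ (cong (λ y → 12 ∸ 3 * y) y≡))) (cong (_+ s) s≡)
            (cong (_+ t) (trans t≡ (cong (2 *_) y≡))) (extend (cubic-cycle y′) p)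
  where
  y′ : Fin 5
  y′ = fromℕ< (s≤s y≤4)
  y≡ : toℕ y′ ≡ y
  y≡ = toℕ-fromℕ< (s≤s y≤4)

-- There are nine pairs with 4i + 3y ≤ 11, and the three hub designs realize each of them.
central-plan : ∀ i y r → 4 * i + 3 * y + r ≡ 11 → Plan 0 r (3 * i) (2 * y)
central-plan 0 0 _ refl = lone (resolveWith hub₀ 0 (hub₀-valid 0F))
central-plan 0 1 _ refl = lone (resolveWith hub₀ 1 (hub₀-valid 1F))
central-plan 0 2 _ refl = lone (resolveWith hub₀ 2 (hub₀-valid 2F))
central-plan 0 3 _ refl = lone (resolveWith hub₀ 3 (hub₀-valid 3F))
central-plan 1 0 _ refl = lone (resolveWith hub₁ 0 (hub₁-valid 0F))
central-plan 1 1 _ refl = lone (resolveWith hub₁ 1 (hub₁-valid 1F))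
central-plan 1 2 _ refl = lone (resolveWith hub₁ 2 (hub₁-valid 2F))
central-plan 2 0 _ refl = lone (resolveWith hub₂ 0 (hub₂-valid 0F))
central-plan 2 1 _ refl = lone (resolveWith hub₂ 1 (hub₂-valid 1F))
central-plan 0 (suc (suc (suc (suc y)))) r eq =
  contradiction (m+n≤o⇒m≤o _ (≤-reflexive eq)) (<⇒≱ (*-monoʳ-≤ 3 (m≤m+n 4 y)))
central-plan 1 (suc (suc (suc y))) r eq =
  contradiction (m+n≤o⇒m≤o _ (≤-reflexive eq)) (<⇒≱ (≤-trans (n≤1+n 12) (+-monoʳ-≤ 4 (*-monoʳ-≤ 3 (m≤m+n 3 y)))))
central-plan 2 (suc (suc y)) r eq =
  contradiction (m+n≤o⇒m≤o _ (≤-reflexive eq)) (<⇒≱ (≤-trans (m≤n+m 12 2) (+-monoʳ-≤ 8 (*-monoʳ-≤ 3 (m≤m+n 2 y)))))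
central-plan (suc (suc (suc i))) y r eq =
  contradiction (m+n≤o⇒m≤o _ (m+n≤o⇒m≤o _ (≤-reflexive eq))) (<⇒≱ (*-monoʳ-≤ 4 (m≤m+n 3 i)))

twelve-more : ∀ h → 11 + suc h * 12 ≡ 12 + (11 + h * 12)
twelve-more = solve-∀

-- Greedy choice: a cycle bundle has degree 12, which is used up by 9 classes of P₃s (i drops by 3)
-- or by 8 classes of P₄s (y drops by 4).
make-plan : ∀ h i y r → 4 * i + 3 * y + r ≡ 11 + h * 12 → Plan h r (3 * i) (2 * y)
make-plan zero    i y r eq = central-plan i y r eq
make-plan (suc h) i y r eq with 3 ≤? i | 4 ≤? y
... | yes 3≤i | _ with m≤n⇒∃[o]m+o≡n 3≤i
...   | i′ , refl = recast refl (sym (*-distribˡ-+ 3 3 i′)) refl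
    (extend triple-cycle (make-plan h i′ y r (+-cancelˡ-≡ 12 _ _ (trans (p i′ y r) (trans eq (twelve-more h))))))
  where
  p : ∀ i y r → 12 + (4 * i + 3 * y + r) ≡ 4 * (3 + i) + 3 * y + r
  p = solve-∀
make-plan (suc h) i y r eq | no _ | yes 4≤y with m≤n⇒∃[o]m+o≡n 4≤y
...   | y′ , refl = recast refl refl (sym (*-distribˡ-+ 2 4 y′))
    (extend-cubic 4 ≤-refl (make-plan h i y′ r (+-cancelˡ-≡ 12 _ _ (trans (p i y′ r) (trans eq (twelve-more h))))))
  where
  p : ∀ i y r → 12 + (4 * i + 3 * y + r) ≡ 4 * i + 3 * (4 + y) + r
  p = solve-∀
-- Now i ≤ 2 and y ≤ 3. This bundle takes all remaining classes of P₄s, the later cycle bundles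
-- become 1-factors, and the hub takes the classes of P₃s.
make-plan (suc h) i y r eq | no 3≰i | no 4≰y = recast r≡ refl (+-identityʳ (2 * y))
    (extend-cubic y (<⇒≤ y<4) (make-plan h i 0 (11 ∸ 4 * i + h * 12) (begin
      4 * i + 3 * 0 + (11 ∸ 4 * i + h * 12) ≡⟨ p (4 * i) (11 ∸ 4 * i) (h * 12) ⟩
      4 * i + (11 ∸ 4 * i) + h * 12         ≡⟨ cong (_+ h * 12) (m+[n∸m]≡n 4i≤11) ⟩
      11 + h * 12                           ∎)))
  where
  open ≡-Reasoning
  y<4 : y < 4
  y<4 = ≰⇒> 4≰y
  4i≤11 : 4 * i ≤ 11
  4i≤11 = ≤-trans (*-monoʳ-≤ 4 (s≤s⁻¹ (≰⇒> 3≰i))) (m≤n+m 8 3)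
  3y≤12 : 3 * y ≤ 12
  3y≤12 = *-monoʳ-≤ 3 (<⇒≤ y<4)
  p : ∀ a b c → a + 0 + (b + c) ≡ a + b + c
  p = solve-∀
  q : ∀ a a′ b b′ c → a + b + (b′ + (a′ + c)) ≡ a + a′ + (b + b′) + c
  q = solve-∀
  r≡ : 12 ∸ 3 * y + (11 ∸ 4 * i + h * 12) ≡ r
  r≡ = +-cancelˡ-≡ (4 * i + 3 * y) _ _ (begin
    4 * i + 3 * y + (12 ∸ 3 * y + (11 ∸ 4 * i + h * 12))
      ≡⟨ q (4 * i) (11 ∸ 4 * i) (3 * y) (12 ∸ 3 * y) (h * 12) ⟩
    4 * i + (11 ∸ 4 * i) + (3 * y + (12 ∸ 3 * y)) + h * 12
      ≡⟨ cong₂ (λ a b → a + b + h * 12) (m+[n∸m]≡n 4i≤11) (m+[n∸m]≡n 3y≤12) ⟩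
    11 + suc h * 12
      ≡⟨ eq ⟨
    4 * i + 3 * y + r ∎)

URD-exists : ∀ h i y r → 4 * i + 3 * y + r ≡ 11 + h * 12 → URD (suc h * 12) r (3 * i) (2 * y)
URD-exists h i y r eq = plan⇒URD (make-plan h i y r eq)

-- The arithmetic of D

open import Data.Integer.Base as ℤ using (+_; +≤+)
open import Data.Integer.DivMod using (div-pos-is-/ℕ)
open import Data.Integer.Properties as ℤ using (pos-+; pos-*; drop‿+≤+)
open import Data.Integer.Tactic.RingSolver as ℤSolver using ()

exact-quotient : ∀ {m} q d → m ≡ q * suc d → (+ m) ℤ./ + suc d ≡ + q
exact-quotient q d refl = trans (div-pos-is-/ℕ (+ (q * suc d)) (suc d)) (cong +_ (m*n/n≡m q (suc d)))

remainder-cases : ∀ i → ∃[ q ] Σ[ ρ ∈ Fin 3 ] i ≡ toℕ ρ + q * 3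
remainder-cases i with i % 3 | i / 3 | m≡m%n+[m/n]*n i 3 | m%n<n i 3
... | 0 | q | eq | _ = q , 0F , eq
... | 1 | q | eq | _ = q , 1F , eq
... | 2 | q | eq | _ = q , 2F , eq
... | suc (suc (suc _)) | _ | _ | s≤s (s≤s (s≤s ()))

4·3q/3 : ∀ q → (+ 4 ℤ.* + (q * 3)) ℤ./ + 3 ≡ + (4 * q)
4·3q/3 q = trans (cong (ℤ._/ + 3) (sym (pos-* 4 (q * 3)))) (exact-quotient (4 * q) 2 (sym (*-assoc 4 q 3)))

-- For v = 12(h + 1) and i = ρ + 3q, the quotient (v - 3(ρ + 1)) / 3 is 3 - ρ + 4h, and 4(i - ρ) / 3
-- is 4q.
rMax≡ : ∀ h q (ρ : Fin 3) → rMax (suc h * 12) (toℕ ρ + q * 3) ≡ + (3 ∸ toℕ ρ + h * 4) ℤ.- + (4 * q)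
rMax≡ h q 0F rewrite [m+kn]%n≡m%n 0 q 3 ⦃ nonZero ⦄ = cong₂ ℤ._-_ (exact-quotient (3 + h * 4) 2 (p h)) (4·3q/3 q)
  where
  p : ∀ h → 9 + h * 12 ≡ (3 + h * 4) * 3
  p = solve-∀
rMax≡ h q 1F rewrite [m+kn]%n≡m%n 1 q 3 ⦃ nonZero ⦄ = cong₂ ℤ._-_ (exact-quotient (2 + h * 4) 2 (p h)) (4·3q/3 q)
  where
  p : ∀ h → 6 + h * 12 ≡ (2 + h * 4) * 3
  p = solve-∀
rMax≡ h q 2F rewrite [m+kn]%n≡m%n 2 q 3 ⦃ nonZero ⦄ = cong₂ ℤ._-_ (exact-quotient (1 + h * 4) 2 (p h)) (4·3q/3 q)
  where
  p : ∀ h → 3 + h * 12 ≡ (1 + h * 4) * 3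
  p = solve-∀

≤-⇒+≤ : ∀ {y a b} → + y ℤ.≤ + a ℤ.- + b → y + b ≤ a
≤-⇒+≤ {y} {a} {b} le = drop‿+≤+ (subst₂ ℤ._≤_ (sym (pos-+ y b)) (p (+ a) (+ b)) (ℤ.+-monoˡ-≤ (+ b) le))
  where
  p : ∀ a b → a ℤ.- b ℤ.+ b ≡ a
  p = ℤSolver.solve-∀

+≤⇒≤- : ∀ {y a b} → y + b ≤ a → + y ℤ.≤ + a ℤ.- + b
+≤⇒≤- {y} {a} {b} le = subst (ℤ._≤ + a ℤ.- + b) (trans (cong (ℤ._- + b) (pos-+ y b)) (p (+ y) (+ b)))
  (ℤ.+-monoˡ-≤ (ℤ.- + b) (+≤+ le))
  where
  p : ∀ a b → a ℤ.+ b ℤ.- b ≡ a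
  p = ℤSolver.solve-∀

bound⇒room : ∀ h q (ρ : Fin 3) y → y + 4 * q ≤ 3 ∸ toℕ ρ + h * 4 → 4 * (toℕ ρ + q * 3) + 3 * y ≤ 11 + h * 12
bound⇒room h q ρ y le = ≤-trans (≤-reflexive (p (toℕ ρ) q y)) (≤-trans (+-monoʳ-≤ (4 * toℕ ρ) (*-monoʳ-≤ 3 le)) (room ρ))
  where
  p : ∀ ρ q y → 4 * (ρ + q * 3) + 3 * y ≡ 4 * ρ + 3 * (y + 4 * q)
  p = solve-∀
  room : ∀ ρ → 4 * toℕ ρ + 3 * (3 ∸ toℕ ρ + h * 4) ≤ 11 + h * 12
  room 0F = ≤-trans (≤-reflexive (e h)) (m≤n+m (9 + h * 12) 2)
    where
    e : ∀ h → 4 * 0 + 3 * (3 + h * 4) ≡ 9 + h * 12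
    e = solve-∀
  room 1F = ≤-trans (≤-reflexive (e h)) (m≤n+m (10 + h * 12) 1)
    where
    e : ∀ h → 4 * 1 + 3 * (2 + h * 4) ≡ 10 + h * 12
    e = solve-∀
  room 2F = ≤-reflexive (e h)
    where
    e : ∀ h → 4 * 2 + 3 * (1 + h * 4) ≡ 11 + h * 12
    e = solve-∀

-- The same shortfall 2 - ρ is less than 3, so no larger y leaves the first coordinate non-negative.
room⇒bound : ∀ h q (ρ : Fin 3) y → 4 * (toℕ ρ + q * 3) + 3 * y ≤ 11 + h * 12 → y + 4 * q ≤ 3 ∸ toℕ ρ + h * 4
room⇒bound h q ρ y le = s≤s⁻¹ (*-cancelˡ-< 3 _ _ (+-cancelˡ-< (4 * toℕ ρ) _ _
  (≤-trans (s≤s (≤-trans (≤-reflexive (p (toℕ ρ) q y)) le)) (room ρ))))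
  where
  p : ∀ ρ q y → 4 * ρ + 3 * (y + 4 * q) ≡ 4 * (ρ + q * 3) + 3 * y
  p = solve-∀
  room : ∀ ρ → 12 + h * 12 ≤ 4 * toℕ ρ + 3 * suc (3 ∸ toℕ ρ + h * 4)
  room 0F = ≤-reflexive (e h)
    where
    e : ∀ h → 12 + h * 12 ≡ 4 * 0 + 3 * (4 + h * 4)
    e = solve-∀
  room 1F = ≤-trans (m≤n+m (12 + h * 12) 1) (≤-reflexive (e h))
    where
    e : ∀ h → 13 + h * 12 ≡ 4 * 1 + 3 * (3 + h * 4)
    e = solve-∀
  room 2F = ≤-trans (m≤n+m (12 + h * 12) 2) (≤-reflexive (e h))
    where
    e : ∀ h → 14 + h * 12 ≡ 4 * 2 + 3 * (2 + h * 4)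
    e = solve-∀

≤rMax⇒ : ∀ h i y → + y ℤ.≤ rMax (suc h * 12) i → 4 * i + 3 * y ≤ 11 + h * 12
≤rMax⇒ h i y le with remainder-cases i
... | q , ρ , refl = bound⇒room h q ρ y (≤-⇒+≤ (subst (+ y ℤ.≤_) (rMax≡ h q ρ) le))

⇒≤rMax : ∀ h i y → 4 * i + 3 * y ≤ 11 + h * 12 → + y ℤ.≤ rMax (suc h * 12) i
⇒≤rMax h i y le with remainder-cases i
... | q , ρ , refl = subst (+ y ℤ.≤_) (sym (rMax≡ h q ρ)) (+≤⇒≤- (room⇒bound h q ρ y le))

-- From 4i ≤ v - 1 < v follows i < v/4, that is, i ≤ (v - 4)/4.
⇒i≤ : ∀ h i y → 4 * i + 3 * y ≤ 11 + h * 12 → + i ℤ.≤ (+ (suc h * 12) ℤ.- + 4) ℤ./ + 4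
⇒i≤ h i y le = subst (+ i ℤ.≤_) (sym (exact-quotient (2 + h * 3) 3 (p h)))
  (+≤+ (s≤s⁻¹ (*-cancelˡ-< 4 i (3 + h * 3) (≤-trans (s≤s (≤-trans (m≤m+n (4 * i) (3 * y)) le)) (≤-reflexive (q h))))))
  where
  p : ∀ h → 8 + h * 12 ≡ (2 + h * 3) * 4
  p = solve-∀
  q : ∀ h → 12 + h * 12 ≡ 4 * (3 + h * 3)
  q = solve-∀

degree-triple : ∀ h i y r → 4 * i + 3 * y + r ≡ 11 + h * 12 →
  (+ r , + (3 * i) , + (2 * y)) ≡
  (+ (suc h * 12) ℤ.- + 1 ℤ.- + 4 ℤ.* + i ℤ.- + 3 ℤ.* + y , + 3 ℤ.* + i , + 2 ℤ.* + y)
degree-triple h i y r eq = cong₂ _,_ (sym first) (cong₂ _,_ (pos-* 3 i) (pos-* 2 y))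
  where
  open ≡-Reasoning
  p : ∀ i y r → ℤ.+ 4 ℤ.* i ℤ.+ + 3 ℤ.* y ℤ.+ r ℤ.- + 4 ℤ.* i ℤ.- + 3 ℤ.* y ≡ r
  p = ℤSolver.solve-∀
  first : + (suc h * 12) ℤ.- + 1 ℤ.- + 4 ℤ.* + i ℤ.- + 3 ℤ.* + y ≡ + r
  first = begin
    + (11 + h * 12) ℤ.- + 4 ℤ.* + i ℤ.- + 3 ℤ.* + y
      ≡⟨ cong (λ m → + m ℤ.- + 4 ℤ.* + i ℤ.- + 3 ℤ.* + y) eq ⟨
    + (4 * i + 3 * y + r) ℤ.- + 4 ℤ.* + i ℤ.- + 3 ℤ.* + y
      ≡⟨ cong (λ m → m ℤ.- + 4 ℤ.* + i ℤ.- + 3 ℤ.* + y) (trans (pos-+ (4 * i + 3 * y) r)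
           (cong (ℤ._+ + r) (trans (pos-+ (4 * i) (3 * y)) (cong₂ ℤ._+_ (pos-* 4 i) (pos-* 3 y))))) ⟩
    + 4 ℤ.* + i ℤ.+ + 3 ℤ.* + y ℤ.+ + r ℤ.- + 4 ℤ.* + i ℤ.- + 3 ℤ.* + y
      ≡⟨ p (+ i) (+ y) (+ r) ⟩
    + r ∎

-- Divisibility and the two inclusions

3∣s : ∀ h r s t → 6 * r + 8 * s + 9 * t + 6 ≡ 6 * (suc h * 12) → 3 ∣ s
3∣s h r s t eq = ∣m+n∣m⇒∣n (divides (2 * r + 3 * s + 3 * t + 2) (trans (cong (_+ s) (sym eq)) (p r s t)))
                           (divides (suc h * 24) (q h))
  where
  p : ∀ r s t → 6 * r + 8 * s + 9 * t + 6 + s ≡ (2 * r + 3 * s + 3 * t + 2) * 3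
  p = solve-∀
  q : ∀ h → 6 * (suc h * 12) ≡ suc h * 24 * 3
  q = solve-∀

-- Every other term of the degree equation is even, and 9t is 8t + t.
2∣t : ∀ h r s t → 6 * r + 8 * s + 9 * t + 6 ≡ 6 * (suc h * 12) → 2 ∣ t
2∣t h r s t eq = ∣m+n∣m⇒∣n (divides (suc h * 36) (trans (sym (p r s t)) (trans eq (q h))))
                           (divides (3 * r + 4 * s + 4 * t + 3) (u r s t))
  where
  p : ∀ r s t → 6 * r + 8 * s + 9 * t + 6 ≡ 6 * r + 8 * s + 8 * t + 6 + t
  p = solve-∀
  q : ∀ h → 6 * (suc h * 12) ≡ suc h * 36 * 2
  q = solve-∀
  u : ∀ r s t → 6 * r + 8 * s + 8 * t + 6 ≡ (3 * r + 4 * s + 4 * t + 3) * 2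
  u = solve-∀

cancel-six : ∀ h X → 6 * (1 + X) ≡ 6 * (suc h * 12) → X ≡ 11 + h * 12
cancel-six h X eq = suc-injective (*-cancelˡ-≡ (suc X) (12 + h * 12) 6 eq)

degrees-reduce : ∀ h i y r → 6 * r + 8 * (i * 3) + 9 * (y * 2) + 6 ≡ 6 * (suc h * 12) →
                 4 * i + 3 * y + r ≡ 11 + h * 12
degrees-reduce h i y r eq = cancel-six h (4 * i + 3 * y + r) (trans (p i y r) eq)
  where
  p : ∀ i y r → 6 * (1 + (4 * i + 3 * y + r)) ≡ 6 * r + 8 * (i * 3) + 9 * (y * 2) + 6
  p = solve-∀

degrees-split : ∀ h r s t → 6 * r + 8 * s + 9 * t + 6 ≡ 6 * (suc h * 12) →
  ∃[ i ] ∃[ y ] s ≡ 3 * i × t ≡ 2 * y × 4 * i + 3 * y + r ≡ 11 + h * 12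
degrees-split h r s t eq = split (3∣s h r s t eq) (2∣t h r s t eq)
  where
  split : 3 ∣ s → 2 ∣ t → ∃[ i ] ∃[ y ] s ≡ 3 * i × t ≡ 2 * y × 4 * i + 3 * y + r ≡ 11 + h * 12
  split (divides i refl) (divides y refl) = i , y , *-comm i 3 , *-comm y 2 , degrees-reduce h i y r eq

degrees⇒D : ∀ h i y r → 4 * i + 3 * y + r ≡ 11 + h * 12 → D (suc h * 12) (+ r , + (3 * i) , + (2 * y))
degrees⇒D h i y r eq = i , ⇒i≤ h i y le , + y , +≤+ z≤n , ⇒≤rMax h i y le , degree-triple h i y r eq
  where
  le : 4 * i + 3 * y ≤ 11 + h * 12
  le = m+n≤o⇒m≤o (4 * i + 3 * y) (≤-reflexive eq)

URDSet⊆D : ∀ h {p} → URDSet (suc h * 12) p → D (suc h * 12) p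
URDSet⊆D h (urd {r} {s} {t} design) = in-D (degrees-split h r s t (Counting.degree-equation design z<s))
  where
  in-D : (∃[ i ] ∃[ y ] s ≡ 3 * i × t ≡ 2 * y × 4 * i + 3 * y + r ≡ 11 + h * 12) →
         D (suc h * 12) (+ r , + s , + t)
  in-D (i , y , s≡ , t≡ , eq) =
    subst₂ (λ s t → D (suc h * 12) (+ r , + s , + t)) (sym s≡) (sym t≡) (degrees⇒D h i y r eq)

D⊆URDSet : ∀ h {p} → D (suc h * 12) p → URDSet (suc h * 12) p
D⊆URDSet h (i , _ , + y , _ , y≤ , p≡) = subst (URDSet (suc h * 12)) (sym p≡) (realize (m≤n⇒∃[o]m+o≡n (≤rMax⇒ h i y y≤)))
  where
  realize : (∃[ r ] 4 * i + 3 * y + r ≡ 11 + h * 12) → URDSet (suc h * 12)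
    (+ (suc h * 12) ℤ.- + 1 ℤ.- + 4 ℤ.* + i ℤ.- + 3 ℤ.* + y , + 3 ℤ.* + i , + 2 ℤ.* + y)
  realize (r , eq) = subst (URDSet (suc h * 12)) (degree-triple h i y r eq) (urd (URD-exists h i y r eq))

mainTheorem1 : ∀ (v : ℕ) → 0 < v → 12 ∣ v → URDSet v ≐ D v
mainTheorem1 _ () (divides zero refl)
mainTheorem1 _ _  (divides (suc h) refl) = URDSet⊆D h , D⊆URDSet h
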